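{- Let $h,p,k$ be positive integers with $1\le p\le h$ and $k\ge2$, and let $G$ be the graph on $n=h+(k-1)p$ vertices whose vertex set is the disjoint union of a set $C$ of $h-p$ vertices and $k$ sets $P_1,\dots,P_k$ of $p$ vertices each, such that $C\cup P_j$ is a clique for every $j$ and there are no edges between $P_i$ and $P_j$ for $i\ne j$ (so $G$ is a union of $k$ cliques of order $h$ having a common clique of order $h-p$). Let $S(G)=J_n-I_n-2A(G)$ be the Seidel adjacency matrix of $G$ (equivalently, the adjacency matrix of the signed complete graph on $n$ vertices whose negative edges are exactly the edges of $G$). Then the eigenvalues of $S(G)$ (with multiplicity) are the roots of the polynomial $$F(\lambda)=(1-2p-\lambda)^{\frac{n-h}{p}-1}(1-\lambda)^{n-2-\frac{n-h}{p}}\,s(\lambda),$$ where $$s(\lambda)=-\lambda^3-(2h-n+2p-3)\lambda^2-\big(2h^2-2(h-1)n+2(h-2)p-4h+3\big)\lambda+2h^2-(2h-1)n-2(2h^2-2hn-h+1)p-2h+4(h-n)p^2+1 .$$ In particular, $S(G)$ has eigenvalue $1$ with multiplicity at least $n-h-\frac{n-h}{p}$, and eigenvalue $1-2p$ with multiplicity at least $\frac{n-h}{p}-1$.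
   Context: $A(G)$ is the $0/1$ adjacency matrix of $G$, $J_n$ the $n\times n$ all-ones matrix and $I_n$ the identity matrix. Note $\frac{n-h}{p}=k-1$. -}

module Defs where

open import Data.Nat as ℕ using (ℕ; zero; suc; NonZero)
open import Data.Nat.DivMod using (_/_)
open import Data.Integer using (ℤ; +_; -_; _+_; _-_; _*_; _^_)
open import Data.Fin using (Fin; toℕ; punchIn)
open import Data.Bool using (Bool; true; false; if_then_else_; _∨_; _∧_; not)
open import Relation.Nullary.Decidable using (⌊_⌋)

Matrix : ℕ → Set
Matrix n = Fin n → Fin n → ℤ

sumFin : ∀ n → (Fin n → ℤ) → ℤ
sumFin zero f = + 0
sumFin (suc n) f = f Fin.zero + sumFin n (λ i → f (Fin.suc i))

det : ∀ n → Matrix n → ℤ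
det zero M = + 1
det (suc n) M =
  sumFin (suc n) (λ i → ((- + 1) ^ toℕ i) * (M i Fin.zero *
    det n (λ r c → M (punchIn i r) (Fin.suc c))))

idM : ∀ n → Matrix n
idM n i j = if ⌊ i Data.Fin.≟ j ⌋ then + 1 else + 0

onesM : ∀ n → Matrix n
onesM n i j = + 1

-- Vertex labelling of G on n = h + (k-1)p vertices:
-- vertices 0 .. h-p-1 form C; vertex m ≥ h-p lies in block P_b with
-- b = (m - (h-p)) / p  (b = 0 .. k-1).
inC : (h p : ℕ) → ℕ → Bool
inC h p m = ⌊ m ℕ.<? h ℕ.∸ p ⌋

block : (h p : ℕ) → .{{_ : NonZero p}} → ℕ → ℕ
block h p m = (m ℕ.∸ (h ℕ.∸ p)) / p

adj : (h p : ℕ) → .{{_ : NonZero p}} → ℕ → ℕ → Bool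
adj h p u v = not ⌊ u ℕ.≟ v ⌋ ∧
  (inC h p u ∨ inC h p v ∨ ⌊ block h p u ℕ.≟ block h p v ⌋)

nV : (h p k : ℕ) → ℕ
nV h p k = h ℕ.+ (k ℕ.∸ 1) ℕ.* p

adjM : (h p k : ℕ) → .{{_ : NonZero p}} → Matrix (nV h p k)
adjM h p k i j = if adj h p (toℕ i) (toℕ j) then + 1 else + 0

seidel : (h p k : ℕ) → .{{_ : NonZero p}} → Matrix (nV h p k)
seidel h p k i j =
  onesM (nV h p k) i j - idM (nV h p k) i j - + 2 * adjM h p k i j

shiftM : ∀ n → Matrix n → ℤ → Matrix n
shiftM n M x i j = M i j - x * idM n i j

sPoly : (h p k : ℕ) → ℤ → ℤ
sPoly h p k x =
  let H = + h ; N = + nV h p k ; P = + p in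
  - (x ^ 3)
  - (+ 2 * H - N + + 2 * P - + 3) * x ^ 2
  - (+ 2 * H ^ 2 - + 2 * (H - + 1) * N + + 2 * (H - + 2) * P - + 4 * H + + 3) * x
  + + 2 * H ^ 2 - (+ 2 * H - + 1) * N
  - + 2 * (+ 2 * H ^ 2 - + 2 * H * N - H + + 1) * P
  - + 2 * H + + 4 * (H - N) * P ^ 2 + + 1

-- Write y = 1 - x.  Since S(G) = J - I - 2A(G), we have S(G) - xI = yI + K, where K u v = -1
-- if u and v lie in a common clique (in particular if u = v) and K u v = 1 otherwise; K u v only
-- depends on whether u and v lie in C and on the sets P_j containing them.  Cut the vertices, in
-- their natural order, into consecutive intervals and let Q be the matrix with entries
-- y δ_ab + Σ_{v ∈ interval b} K (first vertex of interval a) v.  If the first vertices of two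
-- adjacent intervals have equal K-rows outside these two intervals, subtracting one row from the
-- other and eliminating with the resulting pivot row merges the two intervals and multiplies det Q
-- by an explicit factor.  Start from singletons preceded by an empty interval, which contributes
-- the factor y of the left-hand side; merge C into one interval (h - p factors y), then each P_j
-- into one interval (p - 1 factors y each), then the other sets P_j into the first one (k - 1
-- factors 1 - 2p - x).  The remaining 2 × 2 determinant times 1 - 2p - x is s(x).

module Submission where

open import Defs
open import Data.Nat using (ℕ; NonZero; _≤_; _∸_)
open import Data.Integer using (ℤ; +_; _-_; _*_; _^_)
open import Relation.Binary.PropositionalEquality using (_≡_)

open import Data.Nat using (zero; suc; _<_; z≤n; s≤s)
import Data.Nat as ℕ
import Data.Nat.Properties as ℕₚ
open import Data.Integer using (-_; _+_)
import Data.Integer.Properties as ℤₚ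
open import Data.Integer.Tactic.RingSolver using (solve-∀)
import Data.Nat.Tactic.RingSolver as ℕ-Ring
open import Data.Fin using (Fin; toℕ; fromℕ<; punchIn; punchOut; inject₁)
open import Data.Fin.Properties
  using (_≟_; suc-injective; toℕ-injective; toℕ-inject₁; toℕ-fromℕ<; toℕ<n
        ; punchIn-injective; punchInᵢ≢i; punchIn-punchOut)
open import Algebra.Properties.AbelianGroup ℤₚ.+-0-abelianGroup using (inverseʳ-unique)
open import Data.Vec.Functional using (updateAt)
open import Data.Vec.Functional.Properties using (updateAt-updates; updateAt-minimal)
open import Data.Empty using (⊥; ⊥-elim)
open import Data.Sum using (_⊎_; inj₁; inj₂)
open import Data.Bool using (Bool; true; false; if_then_else_; _∨_; _∧_; not)
open import Data.Bool.Properties using (∨-zeroʳ)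
open import Data.Nat.DivMod using (_/_; /-monoˡ-≤; m*n/n≡m; m<n*o⇒m/o<n)
open import Data.Product using (_×_; _,_)
open import Function using (_∘_; const)
open import Relation.Nullary using (Dec; yes; no)
open import Relation.Nullary.Decidable using (⌊_⌋; dec-true; dec-false; isYes≗does)
open import Relation.Binary.Definitions using (tri<; tri≈; tri>)
open import Relation.Binary.PropositionalEquality
  using (_≢_; refl; sym; trans; cong; cong₂; cong-app; subst; module ≡-Reasoning)

private
  variable
    n : ℕ

sumFin-cong : ∀ n {f g : Fin n → ℤ} → (∀ i → f i ≡ g i) → sumFin n f ≡ sumFin n g
sumFin-cong zero    f≗g = refl
sumFin-cong (suc n) f≗g = cong₂ _+_ (f≗g Fin.zero) (sumFin-cong n (f≗g ∘ Fin.suc))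

sumFin-+ : ∀ n (f g : Fin n → ℤ) → sumFin n (λ i → f i + g i) ≡ sumFin n f + sumFin n g
sumFin-+ zero    f g = refl
sumFin-+ (suc n) f g = trans (cong (_+_ (f Fin.zero + g Fin.zero)) (sumFin-+ n _ _))
                             (interchange (f Fin.zero) (g Fin.zero) _ _)
  where
  interchange : ∀ a b c d → (a + b) + (c + d) ≡ (a + c) + (b + d)
  interchange = solve-∀

sumFin-* : ∀ n (k : ℤ) (f : Fin n → ℤ) → sumFin n (λ i → k * f i) ≡ k * sumFin n f
sumFin-* zero    k f = sym (ℤₚ.*-zeroʳ k)
sumFin-* (suc n) k f = trans (cong (_+_ (k * f Fin.zero)) (sumFin-* n k _))
                             (sym (ℤₚ.*-distribˡ-+ k (f Fin.zero) _))

sumFin-zero : ∀ n (f : Fin n → ℤ) → (∀ i → f i ≡ + 0) → sumFin n f ≡ + 0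
sumFin-zero zero    f f≗0 = refl
sumFin-zero (suc n) f f≗0 = cong₂ _+_ (f≗0 Fin.zero) (sumFin-zero n _ (f≗0 ∘ Fin.suc))

sumFin-punchIn : ∀ n (f : Fin (suc n) → ℤ) (r : Fin (suc n)) →
                 sumFin (suc n) f ≡ f r + sumFin n (f ∘ punchIn r)
sumFin-punchIn n       f Fin.zero    = refl
sumFin-punchIn (suc n) f (Fin.suc r) =
  trans (cong (_+_ (f Fin.zero)) (sumFin-punchIn n (f ∘ Fin.suc) r))
        (left-comm (f Fin.zero) (f (Fin.suc r)) _)
  where
  left-comm : ∀ a b c → a + (b + c) ≡ b + (a + c)
  left-comm = solve-∀

sumFin-single : ∀ n (f : Fin n → ℤ) (r : Fin n) →
                (∀ i → i ≢ r → f i ≡ + 0) → sumFin n f ≡ f r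
sumFin-single (suc n) f r others = begin
  sumFin (suc n) f                   ≡⟨ sumFin-punchIn n f r ⟩
  f r + sumFin n (f ∘ punchIn r)     ≡⟨ cong (_+_ (f r)) (sumFin-zero n _ λ i → others _ (punchInᵢ≢i r i)) ⟩
  f r + + 0                          ≡⟨ ℤₚ.+-identityʳ (f r) ⟩
  f r                                ∎
  where open ≡-Reasoning

punchIn≢ : ∀ {n} {i r : Fin (suc n)} {a : Fin n} (i≢r : i ≢ r) →
           a ≢ punchOut i≢r → punchIn i a ≢ r
punchIn≢ {i = i} i≢r a≢r′ eq =
  a≢r′ (punchIn-injective i _ _ (trans eq (sym (punchIn-punchOut i≢r))))

sumFin-pair : ∀ n (f : Fin n → ℤ) (a b : Fin n) → a ≢ b →
              (∀ i → i ≢ a → i ≢ b → f i ≡ + 0) → sumFin n f ≡ f a + f b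
sumFin-pair (suc n) f a b a≢b others = begin
  sumFin (suc n) f                                  ≡⟨ sumFin-punchIn n f a ⟩
  f a + sumFin n (f ∘ punchIn a)                    ≡⟨ cong (_+_ (f a)) (sumFin-single n _ (punchOut a≢b) others′) ⟩
  f a + f (punchIn a (punchOut a≢b))                ≡⟨ cong (λ i → f a + f i) (punchIn-punchOut a≢b) ⟩
  f a + f b                                         ∎
  where
  open ≡-Reasoning
  others′ : ∀ i → i ≢ punchOut a≢b → f (punchIn a i) ≡ + 0
  others′ i i≢ = others _ (punchInᵢ≢i a i) (punchIn≢ a≢b i≢)

sign : ℕ → ℤ
sign m = (- + 1) ^ m

minor : Matrix (suc n) → Fin (suc n) → Matrix n
minor M i r c = M (punchIn i r) (Fin.suc c)

laplaceTerm : Matrix (suc n) → Fin (suc n) → ℤ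
laplaceTerm {n} M i = sign (toℕ i) * (M i Fin.zero * det n (minor M i))

det-cong : ∀ n {M N : Matrix n} → (∀ i j → M i j ≡ N i j) → det n M ≡ det n N
det-cong zero    M≗N = refl
det-cong (suc n) M≗N = sumFin-cong (suc n) λ i →
  cong₂ (λ a d → sign (toℕ i) * (a * d)) (M≗N i Fin.zero) (det-cong n λ r c → M≗N (punchIn i r) (Fin.suc c))

det-2 : ∀ (M : Matrix 2) → det 2 M ≡ M Fin.zero Fin.zero * M (Fin.suc Fin.zero) (Fin.suc Fin.zero)
                                   - M (Fin.suc Fin.zero) Fin.zero * M Fin.zero (Fin.suc Fin.zero)
det-2 M = expand (M Fin.zero Fin.zero) (M Fin.zero (Fin.suc Fin.zero))
                 (M (Fin.suc Fin.zero) Fin.zero) (M (Fin.suc Fin.zero) (Fin.suc Fin.zero))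
  where
  expand : ∀ a b c d → + 1 * (a * (+ 1 * (d * + 1) + + 0)) + ((- + 1) * + 1 * (c * (+ 1 * (b * + 1) + + 0)) + + 0)
                       ≡ a * d - c * b
  expand = solve-∀

AgreeOffRow : Fin n → Matrix n → Matrix n → Set
AgreeOffRow r A B = ∀ i → i ≢ r → ∀ j → A i j ≡ B i j

minor-agreeOffRow : ∀ {A B : Matrix (suc n)} {i r} (i≢r : i ≢ r) →
                    AgreeOffRow r A B → AgreeOffRow (punchOut i≢r) (minor A i) (minor B i)
minor-agreeOffRow i≢r A≈B a a≢r′ c = A≈B _ (punchIn≢ i≢r a≢r′) (Fin.suc c)

minor-at-row : ∀ {A B : Matrix (suc n)} {r} → AgreeOffRow r A B →
               ∀ a c → minor A r a c ≡ minor B r a c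
minor-at-row {r = r} A≈B a c = A≈B _ (punchInᵢ≢i r a) (Fin.suc c)

det-row-linear : ∀ n (A B C : Matrix n) (r : Fin n) (α β : ℤ) →
                 AgreeOffRow r A C → AgreeOffRow r B C →
                 (∀ j → C r j ≡ α * A r j + β * B r j) →
                 det n C ≡ α * det n A + β * det n B
det-row-linear (suc n) A B C r α β A≈C B≈C Cᵣ = begin
  sumFin (suc n) (laplaceTerm C)
    ≡⟨ sumFin-cong (suc n) term ⟩
  sumFin (suc n) (λ i → α * laplaceTerm A i + β * laplaceTerm B i)
    ≡⟨ sumFin-+ (suc n) (λ i → α * laplaceTerm A i) (λ i → β * laplaceTerm B i) ⟩
  sumFin (suc n) (λ i → α * laplaceTerm A i) + sumFin (suc n) (λ i → β * laplaceTerm B i)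
    ≡⟨ cong₂ _+_ (sumFin-* (suc n) α (laplaceTerm A)) (sumFin-* (suc n) β (laplaceTerm B)) ⟩
  α * det (suc n) A + β * det (suc n) B
    ∎
  where
  open ≡-Reasoning
  distrib-entry : ∀ α β s a b d → s * ((α * a + β * b) * d) ≡ α * (s * (a * d)) + β * (s * (b * d))
  distrib-entry = solve-∀
  distrib-minor : ∀ α β s c d e → s * (c * (α * d + β * e)) ≡ α * (s * (c * d)) + β * (s * (c * e))
  distrib-minor = solve-∀
  term : ∀ i → laplaceTerm C i ≡ α * laplaceTerm A i + β * laplaceTerm B i
  term i with i ≟ r
  ... | yes refl =
    trans (cong₂ (λ a d → sign (toℕ i) * (a * d)) (Cᵣ Fin.zero) (sym minorA≡minorC))
          (trans (distrib-entry α β (sign (toℕ i)) (A i Fin.zero) (B i Fin.zero) _)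
                 (cong (λ d → α * laplaceTerm A i + β * (sign (toℕ i) * (B i Fin.zero * d)))
                       (trans minorA≡minorC (sym minorB≡minorC))))
    where
    minorA≡minorC : det n (minor A i) ≡ det n (minor C i)
    minorA≡minorC = det-cong n (minor-at-row A≈C)
    minorB≡minorC : det n (minor B i) ≡ det n (minor C i)
    minorB≡minorC = det-cong n (minor-at-row B≈C)
  ... | no i≢r =
    trans (cong₂ (λ a d → sign (toℕ i) * (a * d)) (sym (A≈C i i≢r Fin.zero)) minorC-linear)
          (trans (distrib-minor α β (sign (toℕ i)) (A i Fin.zero) _ _)
                 (cong (λ b → α * laplaceTerm A i + β * (sign (toℕ i) * (b * det n (minor B i))))
                       (trans (A≈C i i≢r Fin.zero) (sym (B≈C i i≢r Fin.zero)))))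
    where
    minorC-linear : det n (minor C i) ≡ α * det n (minor A i) + β * det n (minor B i)
    minorC-linear = det-row-linear n (minor A i) (minor B i) (minor C i) (punchOut i≢r) α β
      (minor-agreeOffRow i≢r A≈C) (minor-agreeOffRow i≢r B≈C)
      λ c → subst (λ k → C k (Fin.suc c) ≡ α * A k (Fin.suc c) + β * B k (Fin.suc c))
                  (sym (punchIn-punchOut i≢r)) (Cᵣ (Fin.suc c))

det-row-+ : ∀ n (A B C : Matrix n) (r : Fin n) → AgreeOffRow r A C → AgreeOffRow r B C →
            (∀ j → C r j ≡ A r j + B r j) → det n C ≡ det n A + det n B
det-row-+ n A B C r A≈C B≈C Cᵣ =
  trans (det-row-linear n A B C r (+ 1) (+ 1) A≈C B≈C λ j → trans (Cᵣ j) (units (A r j) (B r j)))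
        (sym (units (det n A) (det n B)))
  where
  units : ∀ a b → a + b ≡ + 1 * a + + 1 * b
  units = solve-∀

det-row-* : ∀ n (A B : Matrix n) (r : Fin n) (k : ℤ) → AgreeOffRow r A B →
            (∀ j → B r j ≡ k * A r j) → det n B ≡ k * det n A
det-row-* n A B r k A≈B Bᵣ =
  trans (det-row-linear n A A B r k (+ 0) A≈B A≈B λ j → trans (Bᵣ j) (drop-zero k (A r j)))
        (sym (drop-zero k (det n A)))
  where
  drop-zero : ∀ k a → k * a ≡ k * a + + 0 * a
  drop-zero = solve-∀

data Adjacent : ∀ {n} → Fin n → Fin n → Set where
  adjacent-zero : Adjacent {suc (suc n)} Fin.zero (Fin.suc Fin.zero)
  adjacent-suc  : ∀ {a b : Fin n} → Adjacent a b → Adjacent (Fin.suc a) (Fin.suc b)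

adjacent-≢ : ∀ {a b : Fin n} → Adjacent a b → a ≢ b
adjacent-≢ adjacent-zero    ()
adjacent-≢ (adjacent-suc a~b) = adjacent-≢ a~b ∘ suc-injective

adjacent-toℕ : ∀ {a b : Fin n} → Adjacent a b → toℕ b ≡ suc (toℕ a)
adjacent-toℕ adjacent-zero      = refl
adjacent-toℕ (adjacent-suc a~b) = cong suc (adjacent-toℕ a~b)

inject₁-adjacent : (x : Fin n) → Adjacent (inject₁ x) (Fin.suc x)
inject₁-adjacent Fin.zero    = adjacent-zero
inject₁-adjacent (Fin.suc x) = adjacent-suc (inject₁-adjacent x)

punchIn-adjacent : ∀ {a b : Fin (suc n)} → Adjacent a b → ∀ x →
                   punchIn a x ≡ punchIn b x ⊎ (punchIn a x ≡ b × punchIn b x ≡ a)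
punchIn-adjacent adjacent-zero      Fin.zero    = inj₂ (refl , refl)
punchIn-adjacent adjacent-zero      (Fin.suc x) = inj₁ refl
punchIn-adjacent (adjacent-suc a~b) Fin.zero    = inj₁ refl
punchIn-adjacent (adjacent-suc a~b) (Fin.suc x) with punchIn-adjacent a~b x
... | inj₁ eq         = inj₁ (cong Fin.suc eq)
... | inj₂ (ea , eb)  = inj₂ (cong Fin.suc ea , cong Fin.suc eb)

punchOut-adjacent : ∀ {i a b : Fin (suc n)} → Adjacent a b → (i≢a : i ≢ a) (i≢b : i ≢ b) →
                    Adjacent (punchOut i≢a) (punchOut i≢b)
punchOut-adjacent               {i = Fin.zero}              adjacent-zero      i≢a i≢b = ⊥-elim (i≢a refl)
punchOut-adjacent               {i = Fin.zero}              (adjacent-suc a~b) i≢a i≢b = a~b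
punchOut-adjacent               {i = Fin.suc Fin.zero}      adjacent-zero      i≢a i≢b = ⊥-elim (i≢b refl)
punchOut-adjacent {suc (suc n)} {i = Fin.suc (Fin.suc i)}   adjacent-zero      i≢a i≢b = adjacent-zero
punchOut-adjacent {suc n}       {i = Fin.suc i}             (adjacent-suc a~b) i≢a i≢b =
  adjacent-suc (punchOut-adjacent a~b (i≢a ∘ cong Fin.suc) (i≢b ∘ cong Fin.suc))

-- Deleting either of two equal adjacent rows leaves the same minor, with opposite cofactor signs.
det-adjacent-equal-rows : ∀ n (M : Matrix n) {a b : Fin n} → Adjacent a b →
                          (∀ j → M a j ≡ M b j) → det n M ≡ + 0
det-adjacent-equal-rows (suc n) M {a} {b} a~b Mₐ≡M_b =
  trans (sumFin-pair (suc n) (laplaceTerm M) a b (adjacent-≢ a~b) others) opposite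
  where
  others : ∀ i → i ≢ a → i ≢ b → laplaceTerm M i ≡ + 0
  others i i≢a i≢b =
    trans (cong (λ d → sign (toℕ i) * (M i Fin.zero * d))
                (det-adjacent-equal-rows n (minor M i) (punchOut-adjacent a~b i≢a i≢b) λ c →
                   trans (cong (λ k → M k (Fin.suc c)) (punchIn-punchOut i≢a))
                         (trans (Mₐ≡M_b (Fin.suc c)) (cong (λ k → M k (Fin.suc c)) (sym (punchIn-punchOut i≢b))))))
          (vanish (sign (toℕ i)) (M i Fin.zero))
    where
    vanish : ∀ s m → s * (m * + 0) ≡ + 0
    vanish = solve-∀
  same-minor : ∀ x c → minor M a x c ≡ minor M b x c
  same-minor x c with punchIn-adjacent a~b x
  ... | inj₁ eq        = cong (λ k → M k (Fin.suc c)) eq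
  ... | inj₂ (ea , eb) = trans (cong (λ k → M k (Fin.suc c)) ea)
                               (trans (sym (Mₐ≡M_b (Fin.suc c))) (cong (λ k → M k (Fin.suc c)) (sym eb)))
  cancel : ∀ s m d → s * (m * d) + (- + 1) * s * (m * d) ≡ + 0
  cancel = solve-∀
  opposite : laplaceTerm M a + laplaceTerm M b ≡ + 0
  opposite =
    trans (cong₂ (λ t m → laplaceTerm M a + sign t * (m * det n (minor M b)))
                 (adjacent-toℕ a~b) (sym (Mₐ≡M_b Fin.zero)))
          (trans (cong (λ d → laplaceTerm M a + (- + 1) * sign (toℕ a) * (M a Fin.zero * d))
                       (sym (det-cong n same-minor)))
                 (cancel (sign (toℕ a)) (M a Fin.zero) (det n (minor M a))))

withRows : Fin n → Fin n → (Fin n → ℤ) → (Fin n → ℤ) → Matrix n → Matrix n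
withRows a b u v A = updateAt (updateAt A b (const v)) a (const u)

module _ {a b : Fin n} (a≢b : a ≢ b) (A : Matrix n) where

  withRows-at₁ : ∀ u v → withRows a b u v A a ≡ u
  withRows-at₁ u v = updateAt-updates a _

  withRows-at₂ : ∀ u v → withRows a b u v A b ≡ v
  withRows-at₂ u v = trans (updateAt-minimal b a _ (a≢b ∘ sym)) (updateAt-updates b A)

  withRows-off : ∀ u v i → i ≢ a → i ≢ b → withRows a b u v A i ≡ A i
  withRows-off u v i i≢a i≢b = trans (updateAt-minimal i a _ i≢a) (updateAt-minimal i b A i≢b)

  withRows-agree₁ : ∀ u u′ v → AgreeOffRow a (withRows a b u v A) (withRows a b u′ v A)
  withRows-agree₁ u u′ v i i≢a j =
    cong-app (trans (updateAt-minimal i a (updateAt A b (const v)) i≢a)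
                                (sym (updateAt-minimal i a (updateAt A b (const v)) i≢a))) j

  withRows-agree₂ : ∀ u v v′ → AgreeOffRow b (withRows a b u v A) (withRows a b u v′ A)
  withRows-agree₂ u v v′ i i≢b j with i ≟ a
  ... | yes refl = cong-app (trans (withRows-at₁ u v) (sym (withRows-at₁ u v′))) j
  ... | no i≢a   = cong-app (trans (withRows-off u v i i≢a i≢b) (sym (withRows-off u v′ i i≢a i≢b))) j

withRows-self : ∀ {a b : Fin n} (a≢b : a ≢ b) (A : Matrix n) i → withRows a b (A a) (A b) A i ≡ A i
withRows-self {a = a} {b} a≢b A i with i ≟ a | i ≟ b
... | yes refl | _        = withRows-at₁ a≢b A (A a) (A b)
... | no _     | yes refl = withRows-at₂ a≢b A (A a) (A b)
... | no i≢a   | no i≢b   = withRows-off a≢b A (A a) (A b) i i≢a i≢b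

-- Expand the determinant whose rows a and b both equal row a + row b, by linearity in both rows.
det-adjacent-swap : ∀ n (A : Matrix n) {a b : Fin n} → Adjacent a b →
                    det n (withRows a b (A b) (A a) A) ≡ - det n A
det-adjacent-swap n A {a} {b} a~b = inverseʳ-unique (det n A) (det n (X v u)) sum-zero
  where
  open ≡-Reasoning
  a≢b = adjacent-≢ a~b
  u v w : Fin n → ℤ
  u = A a
  v = A b
  w j = u j + v j
  X : (Fin n → ℤ) → (Fin n → ℤ) → Matrix n
  X p q = withRows a b p q A
  equal-rows-vanish : ∀ p → det n (X p p) ≡ + 0
  equal-rows-vanish p = det-adjacent-equal-rows n (X p p) a~b λ j →
    cong-app (trans (withRows-at₁ a≢b A p p) (sym (withRows-at₂ a≢b A p p))) j
  split₁ : ∀ q → det n (X w q) ≡ det n (X u q) + det n (X v q)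
  split₁ q = det-row-+ n (X u q) (X v q) (X w q) a
    (withRows-agree₁ a≢b A u w q) (withRows-agree₁ a≢b A v w q) λ j →
    trans (cong-app (withRows-at₁ a≢b A w q) j)
          (sym (cong₂ (λ r r′ → r j + r′ j) (withRows-at₁ a≢b A u q) (withRows-at₁ a≢b A v q)))
  split₂ : ∀ p → det n (X p w) ≡ det n (X p u) + det n (X p v)
  split₂ p = det-row-+ n (X p u) (X p v) (X p w) b
    (withRows-agree₂ a≢b A p u w) (withRows-agree₂ a≢b A p v w) λ j →
    trans (cong-app (withRows-at₂ a≢b A p w) j)
          (sym (cong₂ (λ r r′ → r j + r′ j) (withRows-at₂ a≢b A p u) (withRows-at₂ a≢b A p v)))
  sum-zero : det n A + det n (X v u) ≡ + 0
  sum-zero = begin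
    det n A + det n (X v u)
      ≡⟨ cong₂ _+_ (trans (sym (det-cong n λ i j → cong-app (withRows-self a≢b A i) j))
                          (sym (ℤₚ.+-identityˡ _)))
                   (sym (ℤₚ.+-identityʳ _)) ⟩
    (+ 0 + det n (X u v)) + (det n (X v u) + + 0)
      ≡⟨ cong₂ (λ d d′ → d + det n (X u v) + (det n (X v u) + d′))
               (sym (equal-rows-vanish u)) (sym (equal-rows-vanish v)) ⟩
    (det n (X u u) + det n (X u v)) + (det n (X v u) + det n (X v v))
      ≡⟨ cong₂ _+_ (sym (split₂ u)) (sym (split₂ v)) ⟩
    det n (X u w) + det n (X v w)
      ≡⟨ sym (split₁ w) ⟩
    det n (X w w)
      ≡⟨ equal-rows-vanish w ⟩
    + 0 ∎

-- Swap the later of the two equal rows with its predecessor until the two are adjacent.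
det-equal-rows-< : ∀ m n (M : Matrix n) (a b : Fin n) → toℕ b ≡ m → toℕ a < toℕ b →
                   (∀ j → M a j ≡ M b j) → det n M ≡ + 0
det-equal-rows-< zero    n       M a b           b≡0  a<b = ⊥-elim (ℕₚ.n≮0 (subst (toℕ a <_) b≡0 a<b))
det-equal-rows-< (suc m) (suc n) M a (Fin.suc b) b≡m  a<b Mₐ≡M_b with a ≟ inject₁ b
... | yes refl = det-adjacent-equal-rows (suc n) M (inject₁-adjacent b) Mₐ≡M_b
... | no a≢b₋  = ℤₚ.neg-injective (trans (sym (det-adjacent-swap (suc n) M b₋~b)) swapped-vanishes)
  where
  b₋ = inject₁ b
  b₋~b = inject₁-adjacent b
  a≢b : a ≢ Fin.suc b
  a≢b refl = ℕₚ.<-irrefl refl a<b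
  swapped-vanishes : det (suc n) (withRows b₋ (Fin.suc b) (M (Fin.suc b)) (M b₋) M) ≡ + 0
  swapped-vanishes =
    det-equal-rows-< m (suc n) (withRows b₋ (Fin.suc b) (M (Fin.suc b)) (M b₋) M) a b₋
      (trans (toℕ-inject₁ b) (ℕₚ.suc-injective b≡m))
      (ℕₚ.≤∧≢⇒< (subst (toℕ a ≤_) (sym (toℕ-inject₁ b)) (ℕₚ.≤-pred a<b))
                 (a≢b₋ ∘ toℕ-injective))
      λ j → trans (cong-app (withRows-off (adjacent-≢ b₋~b) M (M (Fin.suc b)) (M b₋) a a≢b₋ a≢b) j)
                  (trans (Mₐ≡M_b j) (cong-app (sym (withRows-at₁ (adjacent-≢ b₋~b) M (M (Fin.suc b)) (M b₋))) j))

det-equal-rows : ∀ n (M : Matrix n) {a b : Fin n} → a ≢ b → (∀ j → M a j ≡ M b j) → det n M ≡ + 0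
det-equal-rows n M {a} {b} a≢b Mₐ≡M_b with ℕₚ.<-cmp (toℕ a) (toℕ b)
... | tri< a<b _ _ = det-equal-rows-< (toℕ b) n M a b refl a<b Mₐ≡M_b
... | tri≈ _ a≡b _ = ⊥-elim (a≢b (toℕ-injective a≡b))
... | tri> _ _ b<a = det-equal-rows-< (toℕ a) n M b a refl b<a (sym ∘ Mₐ≡M_b)

det-add-row-multiple : ∀ n (A B : Matrix n) {a s : Fin n} (c : ℤ) → s ≢ a → AgreeOffRow a A B →
                       (∀ j → B a j ≡ A a j + c * A s j) → det n B ≡ det n A
det-add-row-multiple n A B {a} {s} c s≢a A≈B Bₐ = begin
  det n B                          ≡⟨ det-row-linear n A E B a (+ 1) c A≈B E≈B Bₐ′ ⟩
  + 1 * det n A + c * det n E      ≡⟨ cong (λ d → + 1 * det n A + c * d) E-vanishes ⟩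
  + 1 * det n A + c * + 0          ≡⟨ simplify (det n A) c ⟩
  det n A                          ∎
  where
  open ≡-Reasoning
  E : Matrix n
  E = updateAt A a (const (A s))
  Eₐ : ∀ j → E a j ≡ A s j
  Eₐ j = cong-app (updateAt-updates a A) j
  E≈B : AgreeOffRow a E B
  E≈B i i≢a j = trans (cong-app (updateAt-minimal i a A i≢a) j) (A≈B i i≢a j)
  Bₐ′ : ∀ j → B a j ≡ + 1 * A a j + c * E a j
  Bₐ′ j = trans (Bₐ j) (cong₂ _+_ (sym (ℤₚ.*-identityˡ (A a j))) (cong (c *_) (sym (Eₐ j))))
  E-vanishes : det n E ≡ + 0
  E-vanishes = det-equal-rows n E (s≢a ∘ sym) λ j →
    trans (Eₐ j) (sym (cong-app (updateAt-minimal s a A s≢a) j))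
  simplify : ∀ d c → + 1 * d + c * + 0 ≡ d
  simplify = solve-∀

det-add-row-multiples : ∀ n (A : Matrix n) (r : Fin n) (c : Fin n → ℤ) → c r ≡ + 0 →
                        det n (λ i j → A i j + c i * A r j) ≡ det n A
det-add-row-multiples n A r c cᵣ≡0 =
  eliminate n ℕₚ.≤-refl c cᵣ≡0 λ i n≤i → ⊥-elim (ℕₚ.<⇒≱ (toℕ<n i) n≤i)
  where
  added : (Fin n → ℤ) → Matrix n
  added d i j = A i j + d i * A r j
  eliminate : ∀ t → t ≤ n → ∀ d → d r ≡ + 0 → (∀ i → t ≤ toℕ i → d i ≡ + 0) →
              det n (added d) ≡ det n A
  eliminate zero    _   d dᵣ≡0 d≗0 =
    det-cong n λ i j → trans (cong (λ e → A i j + e * A r j) (d≗0 i z≤n)) (ℤₚ.+-identityʳ (A i j))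
  eliminate (suc t) t<n d dᵣ≡0 supported =
    trans (drop-row (i₀ ≟ r)) (eliminate t (ℕₚ.<⇒≤ t<n) d′ d′ᵣ≡0 supported′)
    where
    i₀ = fromℕ< t<n
    d′ = updateAt d i₀ (const (+ 0))
    d′-off : ∀ i → i ≢ i₀ → d′ i ≡ d i
    d′-off i i≢i₀ = updateAt-minimal i i₀ d i≢i₀
    d′ᵣ≡0 : d′ r ≡ + 0
    d′ᵣ≡0 with r ≟ i₀
    ... | yes refl = updateAt-updates i₀ d
    ... | no r≢i₀  = trans (d′-off r r≢i₀) dᵣ≡0
    supported′ : ∀ i → t ≤ toℕ i → d′ i ≡ + 0
    supported′ i t≤i with i ≟ i₀
    ... | yes refl = updateAt-updates i₀ d
    ... | no i≢i₀  = trans (d′-off i i≢i₀) (supported i (ℕₚ.≤∧≢⇒< t≤i λ t≡i →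
                       i≢i₀ (toℕ-injective (trans (sym t≡i) (sym (toℕ-fromℕ< t<n))))))
    drop-row : Dec (i₀ ≡ r) → det n (added d) ≡ det n (added d′)
    drop-row (yes refl) = det-cong n λ i j → cong (λ e → A i j + e * A r j) (d≗d′ i)
      where
      d≗d′ : ∀ i → d i ≡ d′ i
      d≗d′ i with i ≟ i₀
      ... | yes refl = trans dᵣ≡0 (sym (updateAt-updates i₀ d))
      ... | no i≢i₀  = sym (d′-off i i≢i₀)
    drop-row (no i₀≢r) = det-add-row-multiple n (added d′) (added d) (d i₀) (i₀≢r ∘ sym)
      (λ i i≢i₀ j → cong (λ e → A i j + e * A r j) (d′-off i i≢i₀)) λ j →
      sym (trans (cong₂ (λ e e′ → (A i₀ j + e * A r j) + d i₀ * (A r j + e′ * A r j))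
                        (updateAt-updates i₀ d) d′ᵣ≡0)
                 (simplify (A i₀ j) (d i₀) (A r j)))
      where
      simplify : ∀ a c x → (a + + 0 * x) + c * (x + + 0 * x) ≡ a + c * x
      simplify = solve-∀

det-zero-column : ∀ n (M : Matrix n) (s : Fin n) → (∀ i → M i s ≡ + 0) → det n M ≡ + 0
det-zero-column (suc n) M Fin.zero      M·s≡0 = sumFin-zero (suc n) _ λ i →
  trans (cong (λ m → sign (toℕ i) * (m * det n (minor M i))) (M·s≡0 i)) (vanish (sign (toℕ i)) (det n (minor M i)))
  where
  vanish : ∀ s d → s * (+ 0 * d) ≡ + 0
  vanish = solve-∀
det-zero-column (suc n) M (Fin.suc s) M·s≡0 = sumFin-zero (suc n) _ λ i →
  trans (cong (λ d → sign (toℕ i) * (M i Fin.zero * d)) (det-zero-column n (minor M i) s λ a → M·s≡0 _))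
        (vanish (sign (toℕ i)) (M i Fin.zero))
  where
  vanish : ∀ s m → s * (m * + 0) ≡ + 0
  vanish = solve-∀

punchIn-punchIn : ∀ (r : Fin (suc (suc n))) (i r′ : Fin (suc n)) → punchIn (punchIn r i) r′ ≡ r →
                  ∀ a → punchIn (punchIn r i) (punchIn r′ a) ≡ punchIn r (punchIn i a)
punchIn-punchIn         Fin.zero    i           Fin.zero     _    a           = refl
punchIn-punchIn         (Fin.suc r) Fin.zero    r′           refl a           = refl
punchIn-punchIn         (Fin.suc r) (Fin.suc i) (Fin.suc r′) eq   Fin.zero    = refl
punchIn-punchIn {suc n} (Fin.suc r) (Fin.suc i) (Fin.suc r′) eq   (Fin.suc a) =
  cong Fin.suc (punchIn-punchIn r i r′ (suc-injective eq) a)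

sign-punchIn-punchIn : ∀ (r : Fin (suc (suc n))) (i r′ : Fin (suc n)) → punchIn (punchIn r i) r′ ≡ r →
                       sign (toℕ (punchIn r i)) * sign (toℕ r′) ≡ - (sign (toℕ r) * sign (toℕ i))
sign-punchIn-punchIn         Fin.zero    i           Fin.zero     _    = flip₁ (sign (toℕ i))
  where
  flip₁ : ∀ s → (- + 1) * s * + 1 ≡ - (+ 1 * s)
  flip₁ = solve-∀
sign-punchIn-punchIn         (Fin.suc r) Fin.zero    r′           refl = flip₂ (sign (toℕ r))
  where
  flip₂ : ∀ s → + 1 * s ≡ - ((- + 1) * s * + 1)
  flip₂ = solve-∀
sign-punchIn-punchIn {suc n} (Fin.suc r) (Fin.suc i) (Fin.suc r′) eq =
  shift (sign (toℕ (punchIn r i))) (sign (toℕ r′)) (sign (toℕ r)) (sign (toℕ i))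
        (sign-punchIn-punchIn r i r′ (suc-injective eq))
  where
  shift : ∀ a b c d → a * b ≡ - (c * d) → (- + 1) * a * ((- + 1) * b) ≡ - ((- + 1) * c * ((- + 1) * d))
  shift a b c d ab≡-cd = trans (square-out a b) (trans ab≡-cd (cong -_ (sym (square-out c d))))
    where
    square-out : ∀ x y → (- + 1) * x * ((- + 1) * y) ≡ x * y
    square-out = solve-∀

sign-square : ∀ m → sign m * sign m ≡ + 1
sign-square zero    = refl
sign-square (suc m) = trans (square-out (sign m)) (sign-square m)
  where
  square-out : ∀ x → (- + 1) * x * ((- + 1) * x) ≡ x * x
  square-out = solve-∀

det-unit-column : ∀ n (M : Matrix (suc n)) (r s : Fin (suc n)) → M r s ≡ + 1 → (∀ i → i ≢ r → M i s ≡ + 0) →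
                  det (suc n) M ≡ sign (toℕ r) * sign (toℕ s) * det n (λ a b → M (punchIn r a) (punchIn s b))
det-unit-column n M r Fin.zero Mᵣₛ≡1 others =
  trans (sumFin-single (suc n) (laplaceTerm M) r λ i i≢r →
           trans (cong (λ m → sign (toℕ i) * (m * det n (minor M i))) (others i i≢r))
                 (vanish (sign (toℕ i)) (det n (minor M i))))
        (trans (cong (λ m → sign (toℕ r) * (m * det n (minor M r))) Mᵣₛ≡1)
               (unit (sign (toℕ r)) (det n (minor M r))))
  where
  vanish : ∀ s d → s * (+ 0 * d) ≡ + 0
  vanish = solve-∀
  unit : ∀ s d → s * (+ 1 * d) ≡ s * + 1 * d
  unit = solve-∀
det-unit-column (suc n) M r (Fin.suc s) Mᵣₛ≡1 others = begin
  det (suc (suc n)) M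
    ≡⟨ sumFin-punchIn (suc n) (laplaceTerm M) r ⟩
  laplaceTerm M r + sumFin (suc n) (laplaceTerm M ∘ punchIn r)
    ≡⟨ cong₂ _+_ row-r-vanishes (sumFin-cong (suc n) term) ⟩
  + 0 + sumFin (suc n) (λ i → σ * laplaceTerm Q i)
    ≡⟨ ℤₚ.+-identityˡ _ ⟩
  sumFin (suc n) (λ i → σ * laplaceTerm Q i)
    ≡⟨ sumFin-* (suc n) σ (laplaceTerm Q) ⟩
  σ * det (suc n) Q
    ∎
  where
  open ≡-Reasoning
  σ = sign (toℕ r) * sign (toℕ (Fin.suc s))
  Q : Matrix (suc n)
  Q a b = M (punchIn r a) (punchIn (Fin.suc s) b)
  row-r-vanishes : laplaceTerm M r ≡ + 0
  row-r-vanishes =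
    trans (cong (λ d → sign (toℕ r) * (M r Fin.zero * d))
                (det-zero-column (suc n) (minor M r) s λ a → others _ (punchInᵢ≢i r a)))
          (vanish (sign (toℕ r)) (M r Fin.zero))
    where
    vanish : ∀ s m → s * (m * + 0) ≡ + 0
    vanish = solve-∀
  move-signs : ∀ a b c d m t D → a * b ≡ - (c * d) →
               a * (m * (b * t * D)) ≡ c * ((- + 1) * t) * (d * (m * D))
  move-signs a b c d m t D ab≡-cd = begin
    a * (m * (b * t * D))      ≡⟨ regroup a b m t D ⟩
    (a * b) * (t * m * D)      ≡⟨ cong (_* (t * m * D)) ab≡-cd ⟩
    - (c * d) * (t * m * D)    ≡⟨ regroup′ c d m t D ⟩
    c * ((- + 1) * t) * (d * (m * D)) ∎
    where
    regroup : ∀ a b m t D → a * (m * (b * t * D)) ≡ (a * b) * (t * m * D)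
    regroup = solve-∀
    regroup′ : ∀ c d m t D → - (c * d) * (t * m * D) ≡ c * ((- + 1) * t) * (d * (m * D))
    regroup′ = solve-∀
  term : ∀ i → laplaceTerm M (punchIn r i) ≡ σ * laplaceTerm Q i
  term i =
    trans (cong (λ d → sign (toℕ p) * (M p Fin.zero * d))
                (trans unit-in-minor (cong (sign (toℕ r′) * sign (toℕ s) *_) same-minor)))
          (move-signs (sign (toℕ p)) (sign (toℕ r′)) (sign (toℕ r)) (sign (toℕ i)) (M p Fin.zero) (sign (toℕ s))
                      (det n (minor Q i)) (sign-punchIn-punchIn r i r′ back))
    where
    p = punchIn r i
    p≢r = punchInᵢ≢i r i
    r′ = punchOut p≢r
    back : punchIn p r′ ≡ r
    back = punchIn-punchOut p≢r
    unit-in-minor : det (suc n) (minor M p) ≡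
                    sign (toℕ r′) * sign (toℕ s) * det n (λ a b → minor M p (punchIn r′ a) (punchIn s b))
    unit-in-minor = det-unit-column n (minor M p) r′ s (trans (cong (λ k → M k (Fin.suc s)) back) Mᵣₛ≡1)
                      λ a a≢r′ → others _ (punchIn≢ p≢r a≢r′)
    same-minor : det n (λ a b → minor M p (punchIn r′ a) (punchIn s b)) ≡ det n (minor Q i)
    same-minor = det-cong n λ a b → cong (λ k → M k (Fin.suc (punchIn s b))) (punchIn-punchIn r i r′ back a)

det-pivot : ∀ n (M : Matrix (suc n)) (r : Fin (suc n)) → M r r ≡ + 1 →
            det (suc n) M ≡ det n (λ a b → M (punchIn r a) (punchIn r b) - M (punchIn r a) r * M r (punchIn r b))
det-pivot n M r Mᵣᵣ≡1 = begin
  det (suc n) M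
    ≡⟨ sym (det-add-row-multiples (suc n) M r c cᵣ≡0) ⟩
  det (suc n) M′
    ≡⟨ det-unit-column n M′ r r M′ᵣᵣ≡1 column-cleared ⟩
  sign (toℕ r) * sign (toℕ r) * det n (λ a b → M′ (punchIn r a) (punchIn r b))
    ≡⟨ cong (_* det n (λ a b → M′ (punchIn r a) (punchIn r b))) (sign-square (toℕ r)) ⟩
  + 1 * det n (λ a b → M′ (punchIn r a) (punchIn r b))
    ≡⟨ ℤₚ.*-identityˡ _ ⟩
  det n (λ a b → M′ (punchIn r a) (punchIn r b))
    ≡⟨ det-cong n (λ a b → cong (λ e → M (punchIn r a) (punchIn r b) + e * M r (punchIn r b))
                                (c-off (punchIn r a) (punchInᵢ≢i r a))) ⟩
  det n (λ a b → M (punchIn r a) (punchIn r b) + (- M (punchIn r a) r) * M r (punchIn r b))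
    ≡⟨ det-cong n (λ a b → sym (as-difference (M (punchIn r a) (punchIn r b)) (M (punchIn r a) r) (M r (punchIn r b)))) ⟩
  det n (λ a b → M (punchIn r a) (punchIn r b) - M (punchIn r a) r * M r (punchIn r b))
    ∎
  where
  open ≡-Reasoning
  c : Fin (suc n) → ℤ
  c = updateAt (λ i → - M i r) r (const (+ 0))
  cᵣ≡0 : c r ≡ + 0
  cᵣ≡0 = updateAt-updates r _
  c-off : ∀ i → i ≢ r → c i ≡ - M i r
  c-off i i≢r = updateAt-minimal i r _ i≢r
  M′ : Matrix (suc n)
  M′ i j = M i j + c i * M r j
  M′ᵣᵣ≡1 : M′ r r ≡ + 1
  M′ᵣᵣ≡1 = trans (cong₂ (λ m e → m + e * m) Mᵣᵣ≡1 cᵣ≡0) refl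
  column-cleared : ∀ i → i ≢ r → M′ i r ≡ + 0
  column-cleared i i≢r = trans (cong₂ (λ e m → M i r + e * m) (c-off i i≢r) Mᵣᵣ≡1) (cancel (M i r))
    where
    cancel : ∀ x → x + (- x) * + 1 ≡ + 0
    cancel = solve-∀
  as-difference : ∀ x y z → x - y * z ≡ x + (- y) * z
  as-difference = solve-∀

idM-diag : ∀ n (i : Fin n) → idM n i i ≡ + 1
idM-diag n i = cong (λ b → if b then + 1 else + 0) (trans (isYes≗does (i ≟ i)) (dec-true (i ≟ i) refl))

idM-off : ∀ n {i j : Fin n} → i ≢ j → idM n i j ≡ + 0
idM-off n {i} {j} i≢j = cong (λ b → if b then + 1 else + 0) (trans (isYes≗does (i ≟ j)) (dec-false (i ≟ j) i≢j))

contract : Fin (suc n) → Fin (suc n) → Matrix (suc n) → Matrix n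
contract {n} r j M a b = M (punchIn r a) (punchIn r b) + M (punchIn r a) r * idM (suc n) (punchIn r b) j

-- Row r minus row j is λ′ (e_r - e_j), and eliminating with the pivot row e_r - e_j adds column r
-- to column j.
det-merge : ∀ n (M : Matrix (suc n)) (r j : Fin (suc n)) (λ′ : ℤ) → j ≢ r →
            (∀ c → c ≢ r → c ≢ j → M r c ≡ M j c) → M r r - M j r ≡ λ′ → M r j - M j j ≡ - λ′ →
            det (suc n) M ≡ λ′ * det n (contract r j M)
det-merge n M r j λ′ j≢r rows-agree at-r at-j = begin
  det (suc n) M
    ≡⟨ sym (det-add-row-multiple (suc n) M M₁ (- + 1) j≢r M≈M₁ λ c → cong-app (updateAt-updates r M) c) ⟩
  det (suc n) M₁
    ≡⟨ det-row-* (suc n) M₂ M₁ r λ′ M₂≈M₁ M₁ᵣ ⟩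
  λ′ * det (suc n) M₂
    ≡⟨ cong (λ′ *_) (det-pivot n M₂ r (trans (M₂ᵣ r) E-at-r)) ⟩
  λ′ * det n (λ a b → M₂ (punchIn r a) (punchIn r b) - M₂ (punchIn r a) r * M₂ r (punchIn r b))
    ≡⟨ cong (λ′ *_) (det-cong n schur≡contract) ⟩
  λ′ * det n (contract r j M)
    ∎
  where
  open ≡-Reasoning
  δ = idM (suc n)
  E : Fin (suc n) → ℤ
  E c = δ c r - δ c j
  E-at-r : E r ≡ + 1
  E-at-r = cong₂ _-_ (idM-diag (suc n) r) (idM-off (suc n) (j≢r ∘ sym))
  M₁ M₂ : Matrix (suc n)
  M₁ = updateAt M r (const (λ c → M r c + - + 1 * M j c))
  M₂ = updateAt M r (const E)
  off-r : ∀ {X : Fin (suc n) → ℤ} i → i ≢ r → ∀ c → updateAt M r (const X) i c ≡ M i c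
  off-r i i≢r c = cong-app (updateAt-minimal i r M i≢r) c
  M≈M₁ : AgreeOffRow r M M₁
  M≈M₁ i i≢r c = sym (off-r i i≢r c)
  M₂≈M₁ : AgreeOffRow r M₂ M₁
  M₂≈M₁ i i≢r c = trans (off-r i i≢r c) (M≈M₁ i i≢r c)
  M₂ᵣ : ∀ c → M₂ r c ≡ E c
  M₂ᵣ c = cong-app (updateAt-updates r M) c
  difference : ∀ c → M r c - M j c ≡ λ′ * E c
  difference c = by-cases (c ≟ r) (c ≟ j)
    where
    negate : ∀ l → l * (+ 0 - + 1) ≡ - l
    negate = solve-∀
    by-cases : Dec (c ≡ r) → Dec (c ≡ j) → M r c - M j c ≡ λ′ * E c
    by-cases (yes refl) _          = trans at-r (sym (trans (cong (λ′ *_) E-at-r) (ℤₚ.*-identityʳ λ′)))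
    by-cases (no c≢r)   (yes refl) =
      trans at-j (sym (trans (cong₂ (λ d e → λ′ * (d - e)) (idM-off (suc n) c≢r) (idM-diag (suc n) c)) (negate λ′)))
    by-cases (no c≢r)   (no c≢j)   =
      trans (cong (_- M j c) (rows-agree c c≢r c≢j))
            (trans (ℤₚ.+-inverseʳ (M j c))
                   (sym (trans (cong₂ (λ d e → λ′ * (d - e)) (idM-off (suc n) c≢r) (idM-off (suc n) c≢j))
                               (ℤₚ.*-zeroʳ λ′))))
  M₁ᵣ : ∀ c → M₁ r c ≡ λ′ * M₂ r c
  M₁ᵣ c = trans (cong-app (updateAt-updates r M) c)
                (trans (sym (minus-as-plus (M r c) (M j c))) (trans (difference c) (cong (λ′ *_) (sym (M₂ᵣ c)))))
    where
    minus-as-plus : ∀ a b → a - b ≡ a + - + 1 * b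
    minus-as-plus = solve-∀
  schur≡contract : ∀ a b → M₂ (punchIn r a) (punchIn r b) - M₂ (punchIn r a) r * M₂ r (punchIn r b) ≡
                           contract r j M a b
  schur≡contract a b =
    trans (cong₂ (λ m m′ → m - m′ * M₂ r (punchIn r b)) (off-r _ a≢ (punchIn r b)) (off-r _ a≢ r))
          (trans (cong (λ e → M (punchIn r a) (punchIn r b) - M (punchIn r a) r * e)
                       (trans (M₂ᵣ (punchIn r b)) (cong (_- δ (punchIn r b) j) (idM-off (suc n) (punchInᵢ≢i r b)))))
                 (rearrange (M (punchIn r a) (punchIn r b)) (M (punchIn r a) r) (δ (punchIn r b) j)))
    where
    a≢ = punchInᵢ≢i r a
    rearrange : ∀ m u d → m - u * (+ 0 - d) ≡ m + u * d
    rearrange = solve-∀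

sumRange : (ℕ → ℤ) → ℕ → ℕ → ℤ
sumRange f lo zero      = + 0
sumRange f lo (suc len) = f lo + sumRange f (suc lo) len

sumRange-cong : ∀ {f g : ℕ → ℤ} lo len → (∀ v → lo ≤ v → v < lo ℕ.+ len → f v ≡ g v) →
                sumRange f lo len ≡ sumRange g lo len
sumRange-cong lo zero      f≗g = refl
sumRange-cong lo (suc len) f≗g =
  cong₂ _+_ (f≗g lo ℕₚ.≤-refl (ℕₚ.m<m+n lo (s≤s z≤n)))
            (sumRange-cong (suc lo) len λ v lo<v v<end →
               f≗g v (ℕₚ.<⇒≤ lo<v) (subst (v <_) (sym (ℕₚ.+-suc lo len)) v<end))

sumRange-const : ∀ {f : ℕ → ℤ} lo len c → (∀ v → lo ≤ v → v < lo ℕ.+ len → f v ≡ c) →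
                 sumRange f lo len ≡ + len * c
sumRange-const lo len c f≗c = trans (sumRange-cong lo len f≗c) (constant lo len)
  where
  constant : ∀ lo len → sumRange (const c) lo len ≡ + len * c
  constant lo zero      = sym (ℤₚ.*-zeroˡ c)
  constant lo (suc len) = trans (cong (_+_ c) (constant (suc lo) len)) (one-more c (+ len))
    where
    one-more : ∀ c l → c + l * c ≡ (+ 1 + l) * c
    one-more = solve-∀

sumRange-++ : ∀ (f : ℕ → ℤ) lo a b → sumRange f lo (a ℕ.+ b) ≡ sumRange f lo a + sumRange f (lo ℕ.+ a) b
sumRange-++ f lo zero    b = trans (cong (λ l → sumRange f l b) (sym (ℕₚ.+-identityʳ lo)))
                                   (sym (ℤₚ.+-identityˡ _))
sumRange-++ f lo (suc a) b =
  trans (cong (_+_ (f lo)) (trans (sumRange-++ f (suc lo) a b)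
                                  (cong (λ l → sumRange f (suc lo) a + sumRange f l b) (sym (ℕₚ.+-suc lo a)))))
        (sym (ℤₚ.+-assoc (f lo) _ _))

infixr 5 _◂_

_◂_ : ℕ → (ℕ → ℕ) → ℕ → ℕ
(a ◂ f) zero    = a
(a ◂ f) (suc i) = f i

starts : (ℕ → ℕ) → ℕ → ℕ
starts ℓ zero    = 0
starts ℓ (suc i) = ℓ 0 ℕ.+ starts (ℓ ∘ suc) i

merge : ℕ → (ℕ → ℕ) → ℕ → ℕ
merge zero    ℓ = (ℓ 0 ℕ.+ ℓ 1) ◂ (ℓ ∘ suc ∘ suc)
merge (suc j) ℓ = ℓ 0 ◂ merge j (ℓ ∘ suc)

starts-suc : ∀ ℓ i → starts ℓ (suc i) ≡ starts ℓ i ℕ.+ ℓ i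
starts-suc ℓ zero    = ℕₚ.+-identityʳ (ℓ 0)
starts-suc ℓ (suc i) = trans (cong (ℓ 0 ℕ.+_) (starts-suc (ℓ ∘ suc) i))
                             (sym (ℕₚ.+-assoc (ℓ 0) _ _))

starts-mono : ∀ ℓ {i i′} → i ≤ i′ → starts ℓ i ≤ starts ℓ i′
starts-mono ℓ z≤n       = z≤n
starts-mono ℓ (s≤s i≤i′) = ℕₚ.+-monoʳ-≤ (ℓ 0) (starts-mono (ℓ ∘ suc) i≤i′)

starts-cong : ∀ {ℓ ℓ′} i → (∀ c → c < i → ℓ c ≡ ℓ′ c) → starts ℓ i ≡ starts ℓ′ i
starts-cong zero    ℓ≗ℓ′ = refl
starts-cong (suc i) ℓ≗ℓ′ =
  cong₂ ℕ._+_ (ℓ≗ℓ′ 0 (s≤s z≤n)) (starts-cong i λ c c<i → ℓ≗ℓ′ (suc c) (s≤s c<i))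

merge-at : ∀ j ℓ → merge j ℓ j ≡ ℓ j ℕ.+ ℓ (suc j)
merge-at zero    ℓ = refl
merge-at (suc j) ℓ = merge-at j (ℓ ∘ suc)

starts-merge : ∀ ℓ (j x : Fin n) → starts (merge (toℕ j) ℓ) (toℕ x) ≡ starts ℓ (toℕ (punchIn (Fin.suc j) x))
starts-merge ℓ Fin.zero    Fin.zero    = refl
starts-merge ℓ Fin.zero    (Fin.suc x) = ℕₚ.+-assoc (ℓ 0) (ℓ 1) _
starts-merge ℓ (Fin.suc j) Fin.zero    = refl
starts-merge ℓ (Fin.suc j) (Fin.suc x) = cong (ℓ 0 ℕ.+_) (starts-merge (ℓ ∘ suc) j x)

merge-punchIn : ∀ ℓ (j x : Fin n) → punchIn (Fin.suc j) x ≢ inject₁ j →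
                merge (toℕ j) ℓ (toℕ x) ≡ ℓ (toℕ (punchIn (Fin.suc j) x))
merge-punchIn ℓ Fin.zero    Fin.zero    x≢j = ⊥-elim (x≢j refl)
merge-punchIn ℓ Fin.zero    (Fin.suc x) x≢j = refl
merge-punchIn ℓ (Fin.suc j) Fin.zero    x≢j = refl
merge-punchIn ℓ (Fin.suc j) (Fin.suc x) x≢j = merge-punchIn (ℓ ∘ suc) j x (x≢j ∘ cong Fin.suc)

punchIn-suc≡inject₁ : ∀ (j x : Fin n) → punchIn (Fin.suc j) x ≡ inject₁ j → x ≡ j
punchIn-suc≡inject₁ Fin.zero    Fin.zero    _  = refl
punchIn-suc≡inject₁ (Fin.suc j) (Fin.suc x) eq = cong Fin.suc (punchIn-suc≡inject₁ j x (suc-injective eq))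

inject₁≢suc : ∀ (j : Fin n) → inject₁ j ≢ Fin.suc j
inject₁≢suc j = adjacent-≢ (inject₁-adjacent j)

idM-punchIn : ∀ n (r : Fin (suc n)) (a b : Fin n) → idM (suc n) (punchIn r a) (punchIn r b) ≡ idM n a b
idM-punchIn n r a b = by-cases (a ≟ b)
  where
  by-cases : Dec (a ≡ b) → idM (suc n) (punchIn r a) (punchIn r b) ≡ idM n a b
  by-cases (yes refl) = trans (idM-diag (suc n) (punchIn r a)) (sym (idM-diag n a))
  by-cases (no a≢b)   = trans (idM-off (suc n) (a≢b ∘ punchIn-injective r a b)) (sym (idM-off n a≢b))

-- ℓ i is the length of the i-th interval of consecutive vertices; the interval starts at vertex
-- starts ℓ i, which represents it in the rows of quotient m ℓ.
module Quotient (K : ℕ → ℕ → ℤ) (y : ℤ) where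

  quotient : ∀ m → (ℕ → ℕ) → Matrix m
  quotient m ℓ a b = y * idM m a b + sumRange (K (starts ℓ (toℕ a))) (starts ℓ (toℕ b)) (ℓ (toℕ b))

  quotient-cong : ∀ m {ℓ ℓ′} → (∀ i → i < m → ℓ i ≡ ℓ′ i) →
                  det m (quotient m ℓ) ≡ det m (quotient m ℓ′)
  quotient-cong m {ℓ} {ℓ′} ℓ≗ℓ′ = det-cong m λ a b →
    cong (_+_ (y * idM m a b))
         (trans (cong₂ (λ u lo → sumRange (K u) lo (ℓ (toℕ b))) (starts-at a) (starts-at b))
                (cong (sumRange (K (starts ℓ′ (toℕ a))) (starts ℓ′ (toℕ b))) (ℓ≗ℓ′ (toℕ b) (toℕ<n b))))
    where
    starts-at : ∀ x → starts ℓ (toℕ x) ≡ starts ℓ′ (toℕ x)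
    starts-at x = starts-cong (toℕ x) λ c c<x → ℓ≗ℓ′ c (ℕₚ.<-trans c<x (toℕ<n x))

  -- The hypotheses of det-merge for the representatives of the intervals j and j + 1.
  record Mergeable (ℓ : ℕ → ℕ) (j : ℕ) (λ′ : ℤ) : Set where
    field
      rows-agree-outside : ∀ v → v < starts ℓ j ⊎ starts ℓ (2 ℕ.+ j) ≤ v →
                           K (starts ℓ (suc j)) v ≡ K (starts ℓ j) v
      at-second : y + sumRange (K (starts ℓ (suc j))) (starts ℓ (suc j)) (ℓ (suc j))
                    - sumRange (K (starts ℓ j)) (starts ℓ (suc j)) (ℓ (suc j)) ≡ λ′
      at-first  : sumRange (K (starts ℓ (suc j))) (starts ℓ j) (ℓ j)
                    - (y + sumRange (K (starts ℓ j)) (starts ℓ j) (ℓ j)) ≡ - λ′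

  mergeable-equal-rows : ∀ ℓ j → (∀ v → K (starts ℓ (suc j)) v ≡ K (starts ℓ j) v) → Mergeable ℓ j y
  mergeable-equal-rows ℓ j rows≡ = record
    { rows-agree-outside = λ v _ → rows≡ v
    ; at-second = trans (cong (λ s → y + s - sumRange (K (starts ℓ j)) (starts ℓ (suc j)) (ℓ (suc j))) (same (suc j)))
                        (cancel₁ y (sumRange (K (starts ℓ j)) (starts ℓ (suc j)) (ℓ (suc j))))
    ; at-first  = trans (cong (λ s → s - (y + sumRange (K (starts ℓ j)) (starts ℓ j) (ℓ j))) (same j))
                        (cancel₂ y (sumRange (K (starts ℓ j)) (starts ℓ j) (ℓ j)))
    }
    where
    same : ∀ c → sumRange (K (starts ℓ (suc j))) (starts ℓ c) (ℓ c) ≡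
                 sumRange (K (starts ℓ j)) (starts ℓ c) (ℓ c)
    same c = sumRange-cong (starts ℓ c) (ℓ c) λ v _ _ → rows≡ v
    cancel₁ : ∀ y s → y + s - s ≡ y
    cancel₁ = solve-∀
    cancel₂ : ∀ y s → s - (y + s) ≡ - y
    cancel₂ = solve-∀

  mergeable-at : ∀ ℓ j {λ′ a₀ a₁ a₂} →
                 starts ℓ j ≡ a₀ → starts ℓ (suc j) ≡ a₁ → starts ℓ (2 ℕ.+ j) ≡ a₂ →
                 (∀ v → v < a₀ ⊎ a₂ ≤ v → K a₁ v ≡ K a₀ v) →
                 y + sumRange (K a₁) a₁ (ℓ (suc j)) - sumRange (K a₀) a₁ (ℓ (suc j)) ≡ λ′ →
                 sumRange (K a₁) a₀ (ℓ j) - (y + sumRange (K a₀) a₀ (ℓ j)) ≡ - λ′ →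
                 Mergeable ℓ j λ′
  mergeable-at ℓ j refl refl refl outside second first = record
    { rows-agree-outside = outside ; at-second = second ; at-first = first }

  resize : ∀ {m m′} ℓ → m ≡ m′ → det m (quotient m ℓ) ≡ det m′ (quotient m′ ℓ)
  resize ℓ = cong (λ m → det m (quotient m ℓ))

  quotient-merge : ∀ m ℓ (j : Fin m) {λ′} → Mergeable ℓ (toℕ j) λ′ →
                   det (suc m) (quotient (suc m) ℓ) ≡ λ′ * det m (quotient m (merge (toℕ j) ℓ))
  quotient-merge m ℓ j {λ′} mergeable =
    trans (det-merge m M r jᵢ λ′ (inject₁≢suc j) rows-agree at-r at-j)
          (cong (λ′ *_) (det-cong m contract≡quotient))
    where
    open Mergeable mergeable
    M = quotient (suc m) ℓ
    r = Fin.suc j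
    jᵢ = inject₁ j
    s = starts ℓ
    δ = idM (suc m)
    j′ = toℕ j
    entry : ∀ a b {ta tb} → toℕ a ≡ ta → toℕ b ≡ tb → M a b ≡ y * δ a b + sumRange (K (s ta)) (s tb) (ℓ tb)
    entry a b refl refl = refl
    toℕ-jᵢ = toℕ-inject₁ j
    outside : ∀ c v → toℕ c ≢ j′ → toℕ c ≢ suc j′ → s (toℕ c) ≤ v → v < s (toℕ c) ℕ.+ ℓ (toℕ c) →
              v < s j′ ⊎ s (2 ℕ.+ j′) ≤ v
    outside c v c≢j c≢r lo≤v v<hi with ℕₚ.<-cmp (toℕ c) j′
    ... | tri< c<j _ _ = inj₁ (ℕₚ.<-≤-trans (subst (v <_) (sym (starts-suc ℓ (toℕ c))) v<hi) (starts-mono ℓ c<j))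
    ... | tri≈ _ c≡j _ = ⊥-elim (c≢j c≡j)
    ... | tri> _ _ j<c = inj₂ (ℕₚ.≤-trans (starts-mono ℓ (ℕₚ.≤∧≢⇒< j<c (c≢r ∘ sym))) lo≤v)
    rows-agree : ∀ c → c ≢ r → c ≢ jᵢ → M r c ≡ M jᵢ c
    rows-agree c c≢r c≢jᵢ =
      trans (cong₂ (λ d S → y * d + S) (idM-off (suc m) (c≢r ∘ sym))
                   (sumRange-cong (s (toℕ c)) (ℓ (toℕ c)) λ v lo≤v v<hi →
                      rows-agree-outside v (outside c v (c≢jᵢ ∘ toℕ-injective ∘ λ eq → trans eq (sym toℕ-jᵢ))
                                                        (c≢r ∘ toℕ-injective) lo≤v v<hi)))
            (sym (trans (entry jᵢ c toℕ-jᵢ refl)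
                        (cong (λ d → y * d + sumRange (K (s j′)) (s (toℕ c)) (ℓ (toℕ c)))
                              (idM-off (suc m) (c≢jᵢ ∘ sym)))))
    at-r : M r r - M jᵢ r ≡ λ′
    at-r = trans (cong (_-_ (M r r)) (entry jᵢ r toℕ-jᵢ refl))
                 (trans (cong₂ (λ d e → (y * d + own) - (y * e + other))
                               (idM-diag (suc m) r) (idM-off (suc m) (inject₁≢suc j)))
                        (trans (tidy y own other) at-second))
      where
      own = sumRange (K (s (suc j′))) (s (suc j′)) (ℓ (suc j′))
      other = sumRange (K (s j′)) (s (suc j′)) (ℓ (suc j′))
      tidy : ∀ y a b → (y * + 1 + a) - (y * + 0 + b) ≡ y + a - b
      tidy = solve-∀
    at-j : M r jᵢ - M jᵢ jᵢ ≡ - λ′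
    at-j = trans (cong₂ _-_ (entry r jᵢ refl toℕ-jᵢ) (entry jᵢ jᵢ toℕ-jᵢ toℕ-jᵢ))
                 (trans (cong₂ (λ d e → (y * d + other) - (y * e + own))
                               (idM-off (suc m) (inject₁≢suc j ∘ sym)) (idM-diag (suc m) jᵢ))
                        (trans (tidy y other own) at-first))
      where
      own = sumRange (K (s j′)) (s j′) (ℓ j′)
      other = sumRange (K (s (suc j′))) (s j′) (ℓ j′)
      tidy : ∀ y a b → (y * + 0 + a) - (y * + 1 + b) ≡ a - (y + b)
      tidy = solve-∀
    contract≡quotient : ∀ a b → contract r jᵢ M a b ≡ quotient m (merge j′ ℓ) a b
    contract≡quotient a b = by-cases (pb ≟ jᵢ)
      where
      open ≡-Reasoning
      pa = punchIn r a
      pb = punchIn r b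
      u = s (toℕ pa)
      ℓ′ = merge j′ ℓ
      quotient-entry : quotient m ℓ′ a b ≡ y * δ pa pb + sumRange (K u) (s (toℕ pb)) (ℓ′ (toℕ b))
      quotient-entry = cong₃ (λ d u lo → y * d + sumRange (K u) lo (ℓ′ (toℕ b)))
                             (sym (idM-punchIn m r a b)) (starts-merge ℓ j a) (starts-merge ℓ j b)
        where
        cong₃ : ∀ {A B C D : Set} (f : A → B → C → D) {a a′ b b′ c c′} →
                a ≡ a′ → b ≡ b′ → c ≡ c′ → f a b c ≡ f a′ b′ c′
        cong₃ f refl refl refl = refl
      by-cases : Dec (pb ≡ jᵢ) → contract r jᵢ M a b ≡ quotient m ℓ′ a b
      by-cases (yes pb≡jᵢ) = begin
        M pa pb + M pa r * δ pb jᵢ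
          ≡⟨ cong₂ (λ X e → X + (y * δ pa r + second) * e) (entry pa pb refl pb≡j′) δ-pb-jᵢ ⟩
        (y * δ pa pb + first) + (y * δ pa r + second) * + 1
          ≡⟨ cong (λ e → (y * δ pa pb + first) + (y * e + second) * + 1) (idM-off (suc m) (punchInᵢ≢i r a)) ⟩
        (y * δ pa pb + first) + (y * + 0 + second) * + 1
          ≡⟨ tidy y (δ pa pb) first second ⟩
        y * δ pa pb + (first + second)
          ≡⟨ cong (λ S → y * δ pa pb + S) (sym merged-block) ⟩
        y * δ pa pb + sumRange (K u) (s j′) (ℓ′ (toℕ b))
          ≡⟨ cong (λ lo → y * δ pa pb + sumRange (K u) (s lo) (ℓ′ (toℕ b))) (sym pb≡j′) ⟩
        y * δ pa pb + sumRange (K u) (s (toℕ pb)) (ℓ′ (toℕ b))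
          ≡⟨ sym quotient-entry ⟩
        quotient m ℓ′ a b ∎
        where
        pb≡j′ : toℕ pb ≡ j′
        pb≡j′ = trans (cong toℕ pb≡jᵢ) toℕ-jᵢ
        δ-pb-jᵢ : δ pb jᵢ ≡ + 1
        δ-pb-jᵢ = trans (cong (λ c → δ c jᵢ) pb≡jᵢ) (idM-diag (suc m) jᵢ)
        first = sumRange (K u) (s j′) (ℓ j′)
        second = sumRange (K u) (s (suc j′)) (ℓ (suc j′))
        merged-block : sumRange (K u) (s j′) (ℓ′ (toℕ b)) ≡ first + second
        merged-block = begin
          sumRange (K u) (s j′) (ℓ′ (toℕ b))
            ≡⟨ cong (λ i → sumRange (K u) (s j′) (ℓ′ i)) (cong toℕ (punchIn-suc≡inject₁ j b pb≡jᵢ)) ⟩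
          sumRange (K u) (s j′) (ℓ′ j′)
            ≡⟨ cong (sumRange (K u) (s j′)) (merge-at j′ ℓ) ⟩
          sumRange (K u) (s j′) (ℓ j′ ℕ.+ ℓ (suc j′))
            ≡⟨ sumRange-++ (K u) (s j′) (ℓ j′) (ℓ (suc j′)) ⟩
          first + sumRange (K u) (s j′ ℕ.+ ℓ j′) (ℓ (suc j′))
            ≡⟨ cong (λ lo → first + sumRange (K u) lo (ℓ (suc j′))) (sym (starts-suc ℓ j′)) ⟩
          first + second ∎
        tidy : ∀ y d a b → (y * d + a) + (y * + 0 + b) * + 1 ≡ y * d + (a + b)
        tidy = solve-∀
      by-cases (no pb≢jᵢ) = begin
        M pa pb + M pa r * δ pb jᵢ
          ≡⟨ cong (λ e → M pa pb + M pa r * e) (idM-off (suc m) pb≢jᵢ) ⟩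
        M pa pb + M pa r * + 0
          ≡⟨ trans (cong (_+_ (M pa pb)) (ℤₚ.*-zeroʳ (M pa r))) (ℤₚ.+-identityʳ (M pa pb)) ⟩
        y * δ pa pb + sumRange (K u) (s (toℕ pb)) (ℓ (toℕ pb))
          ≡⟨ cong (λ len → y * δ pa pb + sumRange (K u) (s (toℕ pb)) len) (sym (merge-punchIn ℓ j b pb≢jᵢ)) ⟩
        y * δ pa pb + sumRange (K u) (s (toℕ pb)) (ℓ′ (toℕ b))
          ≡⟨ sym quotient-entry ⟩
        quotient m ℓ′ a b ∎

  quotient-merges : ∀ a {m} (ℓ : ℕ → ℕ → ℕ) (j : ℕ) (λ′ : ℤ) → j < m →
                    (∀ t → t < a → Mergeable (ℓ t) j λ′) → (∀ t i → merge j (ℓ t) i ≡ ℓ (suc t) i) →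
                    det (a ℕ.+ m) (quotient (a ℕ.+ m) (ℓ 0)) ≡ λ′ ^ a * det m (quotient m (ℓ a))
  quotient-merges zero        ℓ j λ′ j<m mergeable step = sym (ℤₚ.*-identityˡ _)
  quotient-merges (suc a) {m} ℓ j λ′ j<m mergeable step = begin
    det (suc (a ℕ.+ m)) (quotient (suc (a ℕ.+ m)) (ℓ 0))
      ≡⟨ quotient-merge (a ℕ.+ m) (ℓ 0) jF
           (subst (λ i → Mergeable (ℓ 0) i λ′) (sym (toℕ-fromℕ< j<a+m)) (mergeable 0 (s≤s z≤n))) ⟩
    λ′ * det (a ℕ.+ m) (quotient (a ℕ.+ m) (merge (toℕ jF) (ℓ 0)))
      ≡⟨ cong (λ′ *_) (quotient-cong (a ℕ.+ m) λ i _ →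
           trans (cong (λ j → merge j (ℓ 0) i) (toℕ-fromℕ< j<a+m)) (step 0 i)) ⟩
    λ′ * det (a ℕ.+ m) (quotient (a ℕ.+ m) (ℓ 1))
      ≡⟨ cong (λ′ *_) (quotient-merges a (ℓ ∘ suc) j λ′ j<m (λ t t<a → mergeable (suc t) (s≤s t<a))
                                       (step ∘ suc)) ⟩
    λ′ * (λ′ ^ a * det m (quotient m (ℓ (suc a))))
      ≡⟨ sym (ℤₚ.*-assoc λ′ (λ′ ^ a) _) ⟩
    λ′ ^ suc a * det m (quotient m (ℓ (suc a))) ∎
    where
    open ≡-Reasoning
    j<a+m : j < a ℕ.+ m
    j<a+m = ℕₚ.<-≤-trans j<m (ℕₚ.m≤n+m m a)
    jF = fromℕ< j<a+m

  quotient-augment : ∀ n → det (suc n) (quotient (suc n) (0 ◂ const 1)) ≡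
                           y * det n (λ a b → y * idM n a b + K (toℕ a) (toℕ b))
  quotient-augment n = begin
    det (suc n) Q
      ≡⟨ sumFin-single (suc n) (laplaceTerm Q) Fin.zero (λ i i≢0 →
           trans (cong (λ d → sign (toℕ i) * ((y * d + + 0) * det n (minor Q i))) (idM-off (suc n) i≢0))
                 (vanish (sign (toℕ i)) y (det n (minor Q i)))) ⟩
    + 1 * ((y * idM (suc n) Fin.zero Fin.zero + + 0) * det n (minor Q Fin.zero))
      ≡⟨ cong (λ d → + 1 * ((y * d + + 0) * det n (minor Q Fin.zero))) (idM-diag (suc n) Fin.zero) ⟩
    + 1 * ((y * + 1 + + 0) * det n (minor Q Fin.zero))
      ≡⟨ unit y (det n (minor Q Fin.zero)) ⟩
    y * det n (minor Q Fin.zero)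
      ≡⟨ cong (y *_) (det-cong n λ a b →
           cong₂ (λ d S → y * d + S) (idM-punchIn n Fin.zero a b) (single-vertex a b)) ⟩
    y * det n (λ a b → y * idM n a b + K (toℕ a) (toℕ b)) ∎
    where
    open ≡-Reasoning
    Q = quotient (suc n) (0 ◂ const 1)
    vanish : ∀ s y d → s * ((y * + 0 + + 0) * d) ≡ + 0
    vanish = solve-∀
    unit : ∀ y d → + 1 * ((y * + 1 + + 0) * d) ≡ y * d
    unit = solve-∀
    starts-ones : ∀ i → starts (const 1) i ≡ i
    starts-ones zero    = refl
    starts-ones (suc i) = cong suc (starts-ones i)
    single-vertex : ∀ a b → K (starts (const 1) (toℕ a)) (starts (const 1) (toℕ b)) + + 0 ≡ K (toℕ a) (toℕ b)
    single-vertex a b = trans (ℤₚ.+-identityʳ _) (cong₂ K (starts-ones (toℕ a)) (starts-ones (toℕ b)))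

module UnionOfCliques (h p : ℕ) .{{_ : NonZero p}} where

  c₀ : ℕ
  c₀ = h ∸ p

  sameClique : ℕ → ℕ → Bool
  sameClique u v = inC h p u ∨ inC h p v ∨ ⌊ block h p u ℕ.≟ block h p v ⌋

  cliqueSign : Bool → ℤ
  cliqueSign true  = - + 1
  cliqueSign false = + 1

  K : ℕ → ℕ → ℤ
  K u v = cliqueSign (sameClique u v)

  seidel-shift : ∀ k x (i j : Fin (nV h p k)) →
                 shiftM (nV h p k) (seidel h p k) x i j ≡ (+ 1 - x) * idM (nV h p k) i j + K (toℕ i) (toℕ j)
  seidel-shift k x i j = by-cases (i ≟ j)
    where
    N = nV h p k
    by-cases : Dec (i ≡ j) → shiftM N (seidel h p k) x i j ≡ (+ 1 - x) * idM N i j + K (toℕ i) (toℕ j)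
    by-cases (yes refl) =
      trans (cong₂ (λ d a → + 1 - d - + 2 * (if a then + 1 else + 0) - x * d) (idM-diag N i) not-adjacent)
            (trans (diagonal x) (cong (λ d → (+ 1 - x) * d + K (toℕ i) (toℕ i)) (sym (idM-diag N i))))
      where
      u = toℕ i
      not-adjacent : adj h p u u ≡ false
      not-adjacent = cong (λ b → not b ∧ sameClique u u) (trans (isYes≗does (u ℕ.≟ u)) (dec-true (u ℕ.≟ u) refl))
      in-own-clique : sameClique u u ≡ true
      in-own-clique =
        trans (cong (λ b → inC h p u ∨ inC h p u ∨ b)
                    (trans (isYes≗does (block h p u ℕ.≟ block h p u)) (dec-true (block h p u ℕ.≟ block h p u) refl)))
              (trans (cong (inC h p u ∨_) (∨-zeroʳ (inC h p u))) (∨-zeroʳ (inC h p u)))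
      diagonal : ∀ x → + 1 - + 1 - + 2 * + 0 - x * + 1 ≡ (+ 1 - x) * + 1 + K u u
      diagonal x = trans (tidy x) (cong (λ b → (+ 1 - x) * + 1 + cliqueSign b) (sym in-own-clique))
        where
        tidy : ∀ x → + 1 - + 1 - + 2 * + 0 - x * + 1 ≡ (+ 1 - x) * + 1 + - + 1
        tidy = solve-∀
    by-cases (no i≢j) =
      trans (cong₂ (λ d a → + 1 - d - + 2 * (if a then + 1 else + 0) - x * d) (idM-off N i≢j) adjacent-iff)
            (trans (off-diagonal (sameClique (toℕ i) (toℕ j)))
                   (cong (λ d → (+ 1 - x) * d + K (toℕ i) (toℕ j)) (sym (idM-off N i≢j))))
      where
      adjacent-iff : adj h p (toℕ i) (toℕ j) ≡ sameClique (toℕ i) (toℕ j)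
      adjacent-iff = cong (λ b → not b ∧ sameClique (toℕ i) (toℕ j))
                          (trans (isYes≗does (toℕ i ℕ.≟ toℕ j))
                                 (dec-false (toℕ i ℕ.≟ toℕ j) (i≢j ∘ toℕ-injective)))
      off-diagonal : ∀ b → + 1 - + 0 - + 2 * (if b then + 1 else + 0) - x * + 0 ≡ (+ 1 - x) * + 0 + cliqueSign b
      off-diagonal true  = tidy x
        where
        tidy : ∀ x → + 1 - + 0 - + 2 * + 1 - x * + 0 ≡ (+ 1 - x) * + 0 + - + 1
        tidy = solve-∀
      off-diagonal false = tidy x
        where
        tidy : ∀ x → + 1 - + 0 - + 2 * + 0 - x * + 0 ≡ (+ 1 - x) * + 0 + + 1
        tidy = solve-∀

  blockStart : ℕ → ℕ
  blockStart b = c₀ ℕ.+ b ℕ.* p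

  blockStart-+ : ∀ b a → blockStart b ℕ.+ a ℕ.* p ≡ blockStart (b ℕ.+ a)
  blockStart-+ b a = regroup c₀ b a p
    where
    regroup : ∀ c b a p → c ℕ.+ b ℕ.* p ℕ.+ a ℕ.* p ≡ c ℕ.+ (b ℕ.+ a) ℕ.* p
    regroup = ℕ-Ring.solve-∀

  blockStart-suc : ∀ b → blockStart b ℕ.+ p ≡ blockStart (suc b)
  blockStart-suc b = regroup c₀ b p
    where
    regroup : ∀ c b p → c ℕ.+ b ℕ.* p ℕ.+ p ≡ c ℕ.+ (p ℕ.+ b ℕ.* p)
    regroup = ℕ-Ring.solve-∀

  clique≤blockStart : ∀ b → c₀ ≤ blockStart b
  clique≤blockStart b = ℕₚ.m≤m+n c₀ (b ℕ.* p)

  inC-below : ∀ {v} → v < c₀ → inC h p v ≡ true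
  inC-below {v} v<c₀ = trans (isYes≗does (v ℕ.<? c₀)) (dec-true (v ℕ.<? c₀) v<c₀)

  inC-above : ∀ {v} → c₀ ≤ v → inC h p v ≡ false
  inC-above {v} c₀≤v = trans (isYes≗does (v ℕ.<? c₀)) (dec-false (v ℕ.<? c₀) (ℕₚ.≤⇒≯ c₀≤v))

  block-≥ : ∀ b {v} → blockStart b ≤ v → b ≤ block h p v
  block-≥ b {v} start≤v =
    subst (_≤ (v ∸ c₀) / p) (m*n/n≡m b p)
          (/-monoˡ-≤ p (ℕₚ.m+n≤o⇒m≤o∸n (b ℕ.* p) (subst (_≤ v) (ℕₚ.+-comm c₀ (b ℕ.* p)) start≤v)))

  block-< : ∀ b {v} → c₀ ≤ v → v < blockStart b → block h p v < b
  block-< b {v} c₀≤v v<start =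
    m<n*o⇒m/o<n (subst (v ∸ c₀ <_) (ℕₚ.m+n∸m≡n c₀ (b ℕ.* p)) (ℕₚ.∸-monoˡ-< v<start c₀≤v))

  block-≡ : ∀ b {v} → blockStart b ≤ v → v < blockStart (suc b) → block h p v ≡ b
  block-≡ b start≤v v<next =
    ℕₚ.≤-antisym (ℕₚ.≤-pred (block-< (suc b) (ℕₚ.≤-trans (clique≤blockStart b) start≤v) v<next))
                 (block-≥ b start≤v)

  K-clique-column : ∀ u {v} → v < c₀ → K u v ≡ - + 1
  K-clique-column u {v} v<c₀ =
    cong cliqueSign (trans (cong (λ b → inC h p u ∨ b ∨ ⌊ block h p u ℕ.≟ block h p v ⌋) (inC-below v<c₀))
                           (∨-zeroʳ (inC h p u)))

  K-clique-row : ∀ {u} v → u < c₀ → K u v ≡ - + 1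
  K-clique-row {u} v u<c₀ =
    cong (λ b → cliqueSign (b ∨ inC h p v ∨ ⌊ block h p u ℕ.≟ block h p v ⌋)) (inC-below u<c₀)

  K-blocks : ∀ {u v} → c₀ ≤ u → c₀ ≤ v → K u v ≡ cliqueSign ⌊ block h p u ℕ.≟ block h p v ⌋
  K-blocks {u} {v} c₀≤u c₀≤v =
    cong₂ (λ a b → cliqueSign (a ∨ b ∨ ⌊ block h p u ℕ.≟ block h p v ⌋))
          (inC-above c₀≤u) (inC-above c₀≤v)

  K-same-block : ∀ {u v} → c₀ ≤ u → c₀ ≤ v → block h p u ≡ block h p v → K u v ≡ - + 1
  K-same-block {u} {v} c₀≤u c₀≤v same =
    trans (K-blocks c₀≤u c₀≤v) (cong cliqueSign (trans (isYes≗does (block h p u ℕ.≟ block h p v))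
                                                       (dec-true (block h p u ℕ.≟ block h p v) same)))

  K-other-block : ∀ {u v} → c₀ ≤ u → c₀ ≤ v → block h p u ≢ block h p v → K u v ≡ + 1
  K-other-block {u} {v} c₀≤u c₀≤v other =
    trans (K-blocks c₀≤u c₀≤v) (cong cliqueSign (trans (isYes≗does (block h p u ℕ.≟ block h p v))
                                                       (dec-false (block h p u ℕ.≟ block h p v) other)))

  K-same-row : ∀ {u u′} → c₀ ≤ u → c₀ ≤ u′ → block h p u ≡ block h p u′ → ∀ v → K u v ≡ K u′ v
  K-same-row {u} {u′} c₀≤u c₀≤u′ same v =
    cong₂ (λ a b → cliqueSign (a ∨ inC h p v ∨ ⌊ b ℕ.≟ block h p v ⌋))
          (trans (inC-above c₀≤u) (sym (inC-above c₀≤u′))) same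

  own-block-sum : ∀ {u} b → c₀ ≤ u → block h p u ≡ b → sumRange (K u) (blockStart b) p ≡ + p * - + 1
  own-block-sum b c₀≤u in-b = sumRange-const (blockStart b) p (- + 1) λ v start≤v v<end →
    K-same-block c₀≤u (ℕₚ.≤-trans (clique≤blockStart b) start≤v)
      (trans in-b (sym (block-≡ b start≤v (subst (v <_) (blockStart-suc b) v<end))))

  other-blocks-sum : ∀ {u} b a → c₀ ≤ u → block h p u < b ⊎ b ℕ.+ a ≤ block h p u →
                     sumRange (K u) (blockStart b) (a ℕ.* p) ≡ + (a ℕ.* p) * + 1
  other-blocks-sum {u} b a c₀≤u outside = sumRange-const (blockStart b) (a ℕ.* p) (+ 1) λ v start≤v v<end →
    let c₀≤v = ℕₚ.≤-trans (clique≤blockStart b) start≤v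
        b≤v = block-≥ b start≤v
        v<b+a = block-< (b ℕ.+ a) c₀≤v (subst (v <_) (blockStart-+ b a) v<end)
    in K-other-block c₀≤u c₀≤v λ same → case outside same b≤v v<b+a
    where
    case : block h p u < b ⊎ b ℕ.+ a ≤ block h p u → ∀ {w} → block h p u ≡ w → b ≤ w → w < b ℕ.+ a → ⊥
    case (inj₁ u<b)   refl b≤w w<b+a = ℕₚ.<⇒≱ u<b b≤w
    case (inj₂ b+a≤u) refl b≤w w<b+a = ℕₚ.<⇒≱ w<b+a b+a≤u

  clique-row-sum : ∀ {u} lo len → u < c₀ → sumRange (K u) lo len ≡ + len * - + 1
  clique-row-sum lo len u<c₀ = sumRange-const lo len (- + 1) λ v _ _ → K-clique-row v u<c₀

  clique-column-sum : ∀ u → sumRange (K u) 0 c₀ ≡ + c₀ * - + 1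
  clique-column-sum u = sumRange-const 0 c₀ (- + 1) λ v _ v<c₀ → K-clique-column u v<c₀

  block-offset : ∀ b {w} → w < p → block h p (c₀ ℕ.+ (b ℕ.* p ℕ.+ w)) ≡ b
  block-offset b {w} w<p =
    block-≡ b (ℕₚ.+-monoʳ-≤ c₀ (ℕₚ.m≤m+n (b ℕ.* p) w))
              (ℕₚ.+-monoʳ-< c₀ (subst (b ℕ.* p ℕ.+ w <_) (ℕₚ.+-comm (b ℕ.* p) p)
                                      (ℕₚ.+-monoʳ-< (b ℕ.* p) w<p)))

  block-of-start : ∀ b → block h p (blockStart b) ≡ b
  block-of-start b = trans (cong (block h p ∘ (c₀ ℕ.+_)) (sym (ℕₚ.+-identityʳ (b ℕ.* p))))
                           (block-offset b (ℕ.>-nonZero⁻¹ p))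

  other-block-sum : ∀ {u} b → c₀ ≤ u → block h p u ≢ b → sumRange (K u) (blockStart b) p ≡ + p * + 1
  other-block-sum {u} b c₀≤u u∉b = sumRange-const (blockStart b) p (+ 1) λ v start≤v v<end →
    K-other-block c₀≤u (ℕₚ.≤-trans (clique≤blockStart b) start≤v)
      λ same → u∉b (trans same (block-≡ b start≤v (subst (v <_) (blockStart-suc b) v<end)))

  leading-block-row : ∀ t → sumRange (K (blockStart 0)) (blockStart 0) (suc t ℕ.* p) ≡ + p * - + 1 + + (t ℕ.* p) * + 1
  leading-block-row t =
    trans (sumRange-++ (K u) u p (t ℕ.* p))
          (cong₂ _+_ (own-block-sum 0 c₀≤u (block-of-start 0))
                     (trans (cong (λ lo → sumRange (K u) lo (t ℕ.* p)) (blockStart-suc 0))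
                            (other-blocks-sum 1 t c₀≤u (inj₁ (ℕₚ.≤-reflexive (cong suc (block-of-start 0)))))))
    where
    u = blockStart 0
    c₀≤u = clique≤blockStart 0

  prependBlocks : ℕ → (ℕ → ℕ) → ℕ → ℕ
  prependBlocks zero    g = g
  prependBlocks (suc l) g = p ◂ prependBlocks l g

  prependBlocks-cong : ∀ l {g g′ : ℕ → ℕ} → (∀ i → g i ≡ g′ i) → ∀ i → prependBlocks l g i ≡ prependBlocks l g′ i
  prependBlocks-cong zero    g≗g′ i       = g≗g′ i
  prependBlocks-cong (suc l) g≗g′ zero    = refl
  prependBlocks-cong (suc l) g≗g′ (suc i) = prependBlocks-cong l g≗g′ i

  prependBlocks-snoc : ∀ l g i → prependBlocks l (p ◂ g) i ≡ prependBlocks (suc l) g i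
  prependBlocks-snoc zero    g i       = refl
  prependBlocks-snoc (suc l) g zero    = refl
  prependBlocks-snoc (suc l) g (suc i) = prependBlocks-snoc l g i

  prependBlocks-below : ∀ l g {i} → i < l → prependBlocks l g i ≡ p
  prependBlocks-below (suc l) g {zero}  _         = refl
  prependBlocks-below (suc l) g {suc i} (s≤s i<l) = prependBlocks-below l g i<l

  merge-prependBlocks : ∀ l g i → merge l (prependBlocks l g) i ≡ prependBlocks l (merge 0 g) i
  merge-prependBlocks zero    g i       = refl
  merge-prependBlocks (suc l) g zero    = refl
  merge-prependBlocks (suc l) g (suc i) = merge-prependBlocks l g i

  starts-prependBlocks : ∀ l g i → starts (prependBlocks l g) (i ℕ.+ l) ≡ l ℕ.* p ℕ.+ starts g i
  starts-prependBlocks zero    g i = cong (starts g) (ℕₚ.+-identityʳ i)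
  starts-prependBlocks (suc l) g i = begin
    starts (p ◂ prependBlocks l g) (i ℕ.+ suc l)   ≡⟨ cong (starts (p ◂ prependBlocks l g)) (ℕₚ.+-suc i l) ⟩
    p ℕ.+ starts (prependBlocks l g) (i ℕ.+ l)     ≡⟨ cong (p ℕ.+_) (starts-prependBlocks l g i) ⟩
    p ℕ.+ (l ℕ.* p ℕ.+ starts g i)        ≡⟨ sym (ℕₚ.+-assoc p (l ℕ.* p) (starts g i)) ⟩
    suc l ℕ.* p ℕ.+ starts g i            ∎
    where open ≡-Reasoning

  module _ (p≤h : p ≤ h) where

    h≡c₀+p : h ≡ c₀ ℕ.+ p
    h≡c₀+p = sym (ℕₚ.m∸n+n≡m p≤h)

    vertex-count : ∀ k₁ → suc (nV h p (suc k₁)) ≡ c₀ ℕ.+ suc (suc k₁ ℕ.* p)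
    vertex-count k₁ = trans (cong (λ h′ → suc (h′ ℕ.+ k₁ ℕ.* p)) h≡c₀+p) (regroup c₀ p (k₁ ℕ.* p))
      where
      regroup : ∀ c p r → suc (c ℕ.+ p ℕ.+ r) ≡ c ℕ.+ suc (p ℕ.+ r)
      regroup = ℕ-Ring.solve-∀

    unit-multiplicity : ∀ k₁ → nV h p (suc k₁) ∸ suc k₁ ≡ c₀ ℕ.+ suc k₁ ℕ.* (p ∸ 1)
    unit-multiplicity k₁ =
      trans (cong (_∸ suc k₁) (trans (cong (ℕ._+ k₁ ℕ.* p) h≡c₀+p) split)) (ℕₚ.m+n∸n≡m _ (suc k₁))
      where
      regroup : ∀ c q k₁ → c ℕ.+ suc q ℕ.+ k₁ ℕ.* suc q ≡ c ℕ.+ suc k₁ ℕ.* q ℕ.+ suc k₁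
      regroup = ℕ-Ring.solve-∀
      split : c₀ ℕ.+ p ℕ.+ k₁ ℕ.* p ≡ c₀ ℕ.+ suc k₁ ℕ.* (p ∸ 1) ℕ.+ suc k₁
      split = subst (λ P → c₀ ℕ.+ P ℕ.+ k₁ ℕ.* P ≡ c₀ ℕ.+ suc k₁ ℕ.* (P ∸ 1) ℕ.+ suc k₁)
                    (ℕₚ.suc-pred p) (regroup c₀ (p ∸ 1) k₁)

  -- Interval lengths while C is being merged (its first t vertices form one interval), while the
  -- blocks are merged (blocks 0, ..., l - 1 done, first w + 1 vertices of block l merged), and
  -- while the later blocks are merged into block 0 (blocks 0, ..., t merged).
  cliqueMerged : ℕ → ℕ → ℕ
  cliqueMerged t = t ◂ const 1

  blocksMerged : ℕ → ℕ → ℕ → ℕ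
  blocksMerged l w = c₀ ◂ prependBlocks l (suc w ◂ const 1)

  blocksJoined : ℕ → ℕ → ℕ
  blocksJoined t = c₀ ◂ suc t ℕ.* p ◂ const p

  module Merging (x : ℤ) where

    y λ₂ : ℤ
    y = + 1 - x
    λ₂ = + 1 - + 2 * + p - x

    open Quotient K y public

    clique-phase : ∀ m → 0 < m → det (c₀ ℕ.+ m) (quotient (c₀ ℕ.+ m) (cliqueMerged 0)) ≡
                                 y ^ c₀ * det m (quotient m (cliqueMerged c₀))
    clique-phase m 0<m = quotient-merges c₀ cliqueMerged 0 y 0<m mergeable step
      where
      mergeable : ∀ t → t < c₀ → Mergeable (cliqueMerged t) 0 y
      mergeable t t<c₀ = mergeable-equal-rows (cliqueMerged t) 0 λ v →
        trans (K-clique-row v (subst (_< c₀) (sym (ℕₚ.+-identityʳ t)) t<c₀))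
              (sym (K-clique-row v (ℕₚ.≤-<-trans z≤n t<c₀)))
      step : ∀ t i → merge 0 (cliqueMerged t) i ≡ cliqueMerged (suc t) i
      step t zero    = ℕₚ.+-comm t 1
      step t (suc i) = refl

    block-phase : ∀ l m → suc l < m → det ((p ∸ 1) ℕ.+ m) (quotient ((p ∸ 1) ℕ.+ m) (blocksMerged l 0)) ≡
                                       y ^ (p ∸ 1) * det m (quotient m (blocksMerged (suc l) 0))
    block-phase l m l<m =
      trans (quotient-merges (p ∸ 1) (blocksMerged l) (suc l) y l<m mergeable step)
            (cong (y ^ (p ∸ 1) *_) (quotient-cong m λ i _ → completed i))
      where
      mergeable : ∀ w → w < p ∸ 1 → Mergeable (blocksMerged l w) (suc l) y
      mergeable w w<p-1 = mergeable-equal-rows (blocksMerged l w) (suc l)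
        (K-same-row (ℕₚ.m≤m+n c₀ _) (ℕₚ.m≤m+n c₀ _)
                    (trans (block-at 1 suc[w]<p) (sym (block-at 0 (ℕ.>-nonZero⁻¹ p)))))
        where
        g = suc w ◂ const 1
        suc[w]<p : suc w ℕ.+ 0 < p
        suc[w]<p = subst (_< p) (sym (ℕₚ.+-identityʳ (suc w))) (subst (suc (suc w) ≤_) (ℕₚ.suc-pred p) (s≤s w<p-1))
        block-at : ∀ i → starts g i < p → block h p (c₀ ℕ.+ starts (prependBlocks l g) (i ℕ.+ l)) ≡ l
        block-at i gᵢ<p = trans (cong (block h p ∘ (c₀ ℕ.+_)) (starts-prependBlocks l g i)) (block-offset l gᵢ<p)
      step : ∀ w i → merge (suc l) (blocksMerged l w) i ≡ blocksMerged l (suc w) i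
      step w zero    = refl
      step w (suc i) = trans (merge-prependBlocks l (suc w ◂ const 1) i) (prependBlocks-cong l grown i)
        where
        grown : ∀ i → merge 0 (suc w ◂ const 1) i ≡ (suc (suc w) ◂ const 1) i
        grown zero    = ℕₚ.+-comm (suc w) 1
        grown (suc i) = refl
      completed : ∀ i → blocksMerged l (p ∸ 1) i ≡ blocksMerged (suc l) 0 i
      completed zero    = refl
      completed (suc i) = begin
        prependBlocks l (suc (p ∸ 1) ◂ const 1) i   ≡⟨ prependBlocks-cong l full-block i ⟩
        prependBlocks l (p ◂ const 1) i             ≡⟨ prependBlocks-snoc l (const 1) i ⟩
        prependBlocks (suc l) (const 1) i           ≡⟨ prependBlocks-cong (suc l) ones i ⟩
        prependBlocks (suc l) (1 ◂ const 1) i       ∎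
        where
        open ≡-Reasoning
        full-block : ∀ i → (suc (p ∸ 1) ◂ const 1) i ≡ (p ◂ const 1) i
        full-block zero    = ℕₚ.suc-pred p
        full-block (suc i) = refl
        ones : ∀ i → 1 ≡ (1 ◂ const 1) i
        ones zero    = refl
        ones (suc i) = refl

    blocks-phase : ∀ a → det (suc (a ℕ.* p)) (quotient (suc (a ℕ.* p)) (blocksMerged 0 0)) ≡
                         y ^ (a ℕ.* (p ∸ 1)) * det (suc a) (quotient (suc a) (blocksMerged a 0))
    blocks-phase a = from a 0
      where
      from : ∀ a l → det (suc (l ℕ.+ a ℕ.* p)) (quotient (suc (l ℕ.+ a ℕ.* p)) (blocksMerged l 0)) ≡
                     y ^ (a ℕ.* (p ∸ 1)) * det (suc (l ℕ.+ a)) (quotient (suc (l ℕ.+ a)) (blocksMerged (l ℕ.+ a) 0))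
      from zero    l =
        sym (trans (ℤₚ.*-identityˡ _)
                   (cong (λ l′ → det (suc (l ℕ.+ 0)) (quotient (suc (l ℕ.+ 0)) (blocksMerged l′ 0)))
                         (ℕₚ.+-identityʳ l)))
      from (suc a) l = begin
        det (suc (l ℕ.+ suc a ℕ.* p)) (quotient _ (blocksMerged l 0))
          ≡⟨ resize (blocksMerged l 0) sizes ⟩
        det ((p ∸ 1) ℕ.+ m) (quotient _ (blocksMerged l 0))
          ≡⟨ block-phase l m (s≤s (s≤s (ℕₚ.m≤m+n l (a ℕ.* p)))) ⟩
        y ^ (p ∸ 1) * det m (quotient m (blocksMerged (suc l) 0))
          ≡⟨ cong (y ^ (p ∸ 1) *_) (from a (suc l)) ⟩
        y ^ (p ∸ 1) * (y ^ (a ℕ.* (p ∸ 1)) * det (suc (suc l ℕ.+ a)) (quotient _ (blocksMerged (suc l ℕ.+ a) 0)))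
          ≡⟨ sym (ℤₚ.*-assoc (y ^ (p ∸ 1)) _ _) ⟩
        (y ^ (p ∸ 1) * y ^ (a ℕ.* (p ∸ 1))) * det (suc (suc l ℕ.+ a)) (quotient _ (blocksMerged (suc l ℕ.+ a) 0))
          ≡⟨ cong₂ _*_ (sym (ℤₚ.^-distribˡ-+-* y (p ∸ 1) (a ℕ.* (p ∸ 1))))
                       (cong (λ l′ → det (suc l′) (quotient (suc l′) (blocksMerged l′ 0)))
                             (sym (ℕₚ.+-suc l a))) ⟩
        y ^ (suc a ℕ.* (p ∸ 1)) * det (suc (l ℕ.+ suc a)) (quotient _ (blocksMerged (l ℕ.+ suc a) 0))
          ∎
        where
        open ≡-Reasoning
        m = suc (suc l ℕ.+ a ℕ.* p)
        regroup : ∀ l a q → suc (l ℕ.+ suc a ℕ.* suc q) ≡ q ℕ.+ suc (suc l ℕ.+ a ℕ.* suc q)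
        regroup = ℕ-Ring.solve-∀
        sizes : suc (l ℕ.+ suc a ℕ.* p) ≡ (p ∸ 1) ℕ.+ m
        sizes = subst (λ P → suc (l ℕ.+ suc a ℕ.* P) ≡ (P ∸ 1) ℕ.+ suc (suc l ℕ.+ a ℕ.* P))
                      (ℕₚ.suc-pred p) (regroup l a (p ∸ 1))

    joinable : ∀ t → Mergeable (blocksJoined t) 1 λ₂
    joinable t = mergeable-at (blocksJoined t) 1 {a₀ = blockStart 0} {blockStart (suc t)} {blockStart (2 ℕ.+ t)}
      refl (cong (c₀ ℕ.+_) (ℕₚ.+-identityʳ _))
           (cong (c₀ ℕ.+_) (trans (cong (suc t ℕ.* p ℕ.+_) (ℕₚ.+-identityʳ p)) (ℕₚ.+-comm _ p)))
      outside second first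
      where
      u = blockStart (suc t)
      u′ = blockStart 0
      c₀≤u = clique≤blockStart (suc t)
      c₀≤u′ = clique≤blockStart 0
      outside : ∀ v → v < u′ ⊎ blockStart (2 ℕ.+ t) ≤ v → K u v ≡ K u′ v
      outside v (inj₁ v<c₀) = trans (K-clique-column u v<c₀′) (sym (K-clique-column u′ v<c₀′))
        where
        v<c₀′ = subst (v <_) (ℕₚ.+-identityʳ c₀) v<c₀
      outside v (inj₂ later) = trans (K-other-block c₀≤u c₀≤v (beyond (suc t) (ℕₚ.n<1+n (suc t))))
                                     (sym (K-other-block c₀≤u′ c₀≤v (beyond 0 (s≤s z≤n))))
        where
        c₀≤v = ℕₚ.≤-trans (clique≤blockStart (2 ℕ.+ t)) later
        beyond : ∀ b → b < 2 ℕ.+ t → block h p (blockStart b) ≢ block h p v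
        beyond b b<2+t same =
          ℕₚ.<⇒≱ b<2+t (subst (2 ℕ.+ t ≤_) (trans (sym same) (block-of-start b)) (block-≥ (2 ℕ.+ t) later))
      second : y + sumRange (K u) u p - sumRange (K u′) u p ≡ λ₂
      second = trans (cong₂ (λ S S′ → y + S - S′) (own-block-sum (suc t) c₀≤u (block-of-start (suc t)))
                                                  (other-block-sum (suc t) c₀≤u′ λ in-suc-t →
                                                     ℕₚ.0≢1+n (trans (sym (block-of-start 0)) in-suc-t)))
                     (tidy x (+ p))
        where
        tidy : ∀ x P → (+ 1 - x) + P * - + 1 - P * + 1 ≡ + 1 - + 2 * P - x
        tidy = solve-∀
      first : sumRange (K u) u′ (suc t ℕ.* p) - (y + sumRange (K u′) u′ (suc t ℕ.* p)) ≡ - λ₂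
      first = trans (cong₂ (λ S S′ → S - (y + S′))
                           (other-blocks-sum 0 (suc t) c₀≤u (inj₂ (ℕₚ.≤-reflexive (sym (block-of-start (suc t))))))
                           (leading-block-row t))
                    (tidy x (+ p) (+ (t ℕ.* p)))
        where
        tidy : ∀ x P T → (P + T) * + 1 - ((+ 1 - x) + (P * - + 1 + T * + 1)) ≡ - (+ 1 - + 2 * P - x)
        tidy = solve-∀

    join-phase : ∀ a → det (suc (suc a)) (quotient (suc (suc a)) (blocksJoined 0)) ≡
                       λ₂ ^ a * det 2 (quotient 2 (blocksJoined a))
    join-phase a = trans (resize (blocksJoined 0) (ℕₚ.+-comm 2 a))
                         (quotient-merges a blocksJoined 1 λ₂ (s≤s (s≤s z≤n)) (λ t _ → joinable t) step)
      where
      step : ∀ t i → merge 1 (blocksJoined t) i ≡ blocksJoined (suc t) i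
      step t zero          = refl
      step t (suc zero)    = ℕₚ.+-comm (suc t ℕ.* p) p
      step t (suc (suc i)) = refl

    final-det : ∀ t → det 2 (quotient 2 (blocksJoined t)) ≡
                      (y + + c₀ * - + 1) * (y + (+ p * - + 1 + + (t ℕ.* p) * + 1)) - + c₀ * + (suc t ℕ.* p)
    final-det t = begin
      det 2 Q
        ≡⟨ det-2 Q ⟩
      Q 𝟘 𝟘 * Q 𝟙 𝟙 - Q 𝟙 𝟘 * Q 𝟘 𝟙
        ≡⟨ cong₂ _-_ (cong₂ _*_ (cong₂ (λ d S → y * d + S) (idM-diag 2 𝟘) (clique-column-sum 0))
                                (cong₂ (λ d S → y * d + S) (idM-diag 2 𝟙) (leading-block-row t)))
                     corners ⟩
      (y * + 1 + + c₀ * - + 1) * (y * + 1 + (+ p * - + 1 + + (t ℕ.* p) * + 1)) - + c₀ * + (suc t ℕ.* p)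
        ≡⟨ tidy y (+ c₀) (+ p * - + 1 + + (t ℕ.* p) * + 1) (+ c₀ * + (suc t ℕ.* p)) ⟩
      (y + + c₀ * - + 1) * (y + (+ p * - + 1 + + (t ℕ.* p) * + 1)) - + c₀ * + (suc t ℕ.* p)
        ∎
      where
      open ≡-Reasoning
      Q = quotient 2 (blocksJoined t)
      𝟘 𝟙 : Fin 2
      𝟘 = Fin.zero
      𝟙 = Fin.suc Fin.zero
      L = suc t ℕ.* p
      tidy : ∀ y C R X → (y * + 1 + C * - + 1) * (y * + 1 + R) - X ≡ (y + C * - + 1) * (y + R) - X
      tidy = solve-∀
      corners : Q 𝟙 𝟘 * Q 𝟘 𝟙 ≡ + c₀ * + L
      corners = trans (cong₂ (λ d e → (y * d + sumRange (K (blockStart 0)) 0 c₀) *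
                                      (y * e + sumRange (K 0) (blockStart 0) L))
                             (idM-off 2 {𝟙} {𝟘} λ ()) (idM-off 2 {𝟘} {𝟙} λ ()))
                      (trans (cong (λ S → (y * + 0 + S) * (y * + 0 + sumRange (K 0) (blockStart 0) L)) (clique-column-sum _))
                             (by-cases (c₀ ℕ.≟ 0)))
        where
        by-cases : Dec (c₀ ≡ 0) → (y * + 0 + + c₀ * - + 1) * (y * + 0 + sumRange (K 0) (blockStart 0) L) ≡ + c₀ * + L
        -- If c₀ = 0 the first interval is empty and its representative 0 lies in block 0, so
        -- Q 𝟘 𝟙 is no clique-row sum; but then Q 𝟙 𝟘 = 0.
        by-cases (yes c₀≡0) =
          trans (cong (λ c → (y * + 0 + + c * - + 1) * (y * + 0 + sumRange (K 0) (blockStart 0) L)) c₀≡0)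
                (trans (vanish y (sumRange (K 0) (blockStart 0) L) (+ L)) (cong (λ c → + c * + L) (sym c₀≡0)))
          where
          vanish : ∀ y S L → (y * + 0 + + 0 * - + 1) * (y * + 0 + S) ≡ + 0 * L
          vanish = solve-∀
        by-cases (no c₀≢0) =
          trans (cong (λ S → (y * + 0 + + c₀ * - + 1) * (y * + 0 + S))
                      (clique-row-sum (blockStart 0) L (ℕₚ.n≢0⇒n>0 c₀≢0)))
                (signs y (+ c₀) (+ L))
          where
          signs : ∀ y C L → (y * + 0 + C * - + 1) * (y * + 0 + L * - + 1) ≡ C * L
          signs = solve-∀

    characteristic-cubic : p ≤ h → ∀ k₁ →
      λ₂ * ((y + + c₀ * - + 1) * (y + (+ p * - + 1 + + (k₁ ℕ.* p) * + 1)) - + c₀ * + (suc k₁ ℕ.* p))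
        ≡ sPoly h p (suc k₁) x
    characteristic-cubic p≤h k₁ =
      trans (expand (+ c₀) (+ p) (+ (k₁ ℕ.* p)) x)
            (sym (cong₂ (λ H N → cubic H N (+ p)) (cong +_ (h≡c₀+p p≤h))
                                                  (cong (λ h′ → + (h′ ℕ.+ k₁ ℕ.* p)) (h≡c₀+p p≤h))))
      where
      -- sPoly h p k x is definitionally cubic (+ h) (+ nV h p k) (+ p).
      cubic : ℤ → ℤ → ℤ → ℤ
      cubic H N P = - (x * (x * (x * + 1)))
        - (+ 2 * H - N + + 2 * P - + 3) * (x * (x * + 1))
        - (+ 2 * (H * (H * + 1)) - + 2 * (H - + 1) * N + + 2 * (H - + 2) * P - + 4 * H + + 3) * x
        + + 2 * (H * (H * + 1)) - (+ 2 * H - + 1) * N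
        - + 2 * (+ 2 * (H * (H * + 1)) - + 2 * H * N - H + + 1) * P
        - + 2 * H + + 4 * (H - N) * (P * (P * + 1)) + + 1
      expand : ∀ C P T x →
        (+ 1 - + 2 * P - x) * (((+ 1 - x) + C * - + 1) * ((+ 1 - x) + (P * - + 1 + T * + 1)) - C * (P + T))
          ≡ - (x * (x * (x * + 1)))
            - (+ 2 * (C + P) - (C + P + T) + + 2 * P - + 3) * (x * (x * + 1))
            - (+ 2 * ((C + P) * ((C + P) * + 1)) - + 2 * ((C + P) - + 1) * (C + P + T) + + 2 * ((C + P) - + 2) * P
               - + 4 * (C + P) + + 3) * x
            + + 2 * ((C + P) * ((C + P) * + 1)) - (+ 2 * (C + P) - + 1) * (C + P + T)
            - + 2 * (+ 2 * ((C + P) * ((C + P) * + 1)) - + 2 * (C + P) * (C + P + T) - (C + P) + + 1) * P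
            - + 2 * (C + P) + + 4 * ((C + P) - (C + P + T)) * (P * (P * + 1)) + + 1
      expand = solve-∀

    quotient-factorisation : p ≤ h → ∀ k₁ →
      det (suc (nV h p (suc k₁))) (quotient (suc (nV h p (suc k₁))) (cliqueMerged 0))
        ≡ y ^ c₀ * (y ^ (suc k₁ ℕ.* (p ∸ 1)) * (λ₂ ^ k₁ * det 2 (quotient 2 (blocksJoined k₁))))
    quotient-factorisation p≤h k₁ = begin
      det (suc (nV h p (suc k₁))) (quotient _ (cliqueMerged 0))
        ≡⟨ resize (cliqueMerged 0) (vertex-count p≤h k₁) ⟩
      det (c₀ ℕ.+ suc (suc k₁ ℕ.* p)) (quotient _ (cliqueMerged 0))
        ≡⟨ clique-phase (suc (suc k₁ ℕ.* p)) (s≤s z≤n) ⟩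
      y ^ c₀ * det (suc (suc k₁ ℕ.* p)) (quotient _ (cliqueMerged c₀))
        ≡⟨ cong (y ^ c₀ *_) (trans (quotient-cong _ clique-done) (blocks-phase (suc k₁))) ⟩
      y ^ c₀ * (y ^ (suc k₁ ℕ.* (p ∸ 1)) * det (suc (suc k₁)) (quotient _ (blocksMerged (suc k₁) 0)))
        ≡⟨ cong (λ d → y ^ c₀ * (y ^ (suc k₁ ℕ.* (p ∸ 1)) * d))
                (trans (quotient-cong _ blocks-done) (join-phase k₁)) ⟩
      y ^ c₀ * (y ^ (suc k₁ ℕ.* (p ∸ 1)) * (λ₂ ^ k₁ * det 2 (quotient 2 (blocksJoined k₁))))
        ∎
      where
      open ≡-Reasoning
      clique-done : ∀ i → i < suc (suc k₁ ℕ.* p) → cliqueMerged c₀ i ≡ blocksMerged 0 0 i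
      clique-done zero          _ = refl
      clique-done (suc zero)    _ = refl
      clique-done (suc (suc i)) _ = refl
      blocks-done : ∀ i → i < suc (suc k₁) → blocksMerged (suc k₁) 0 i ≡ blocksJoined 0 i
      blocks-done zero          _         = refl
      blocks-done (suc zero)    _         =
        trans (prependBlocks-below (suc k₁) (1 ◂ const 1) (s≤s z≤n)) (sym (ℕₚ.+-identityʳ p))
      blocks-done (suc (suc i)) (s≤s i<k) = prependBlocks-below (suc k₁) (1 ◂ const 1) i<k

theorem2 : (h p k : ℕ) → .{{_ : NonZero p}} → p ≤ h → 2 ≤ k →
    (x : ℤ) →
      (+ 1 - x) * det (nV h p k) (shiftM (nV h p k) (seidel h p k) x)
        ≡ (+ 1 - + 2 * + p - x) ^ (k ∸ 2) * (+ 1 - x) ^ (nV h p k ∸ k) * sPoly h p k x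
theorem2 h p zero          p≤h ()       x
theorem2 h p (suc zero)    p≤h (s≤s ()) x
theorem2 h p (suc (suc k₂)) p≤h _ x = begin
  y * det N (shiftM N (seidel h p k) x)
    ≡⟨ cong (y *_) (det-cong N (seidel-shift k x)) ⟩
  y * det N (λ a b → y * idM N a b + K (toℕ a) (toℕ b))
    ≡⟨ sym (quotient-augment N) ⟩
  det (suc N) (quotient (suc N) (cliqueMerged 0))
    ≡⟨ quotient-factorisation p≤h (suc k₂) ⟩
  y ^ c₀ * (y ^ (k ℕ.* (p ∸ 1)) * (λ₂ ^ suc k₂ * D))
    ≡⟨ regroup (y ^ c₀) (y ^ (k ℕ.* (p ∸ 1))) λ₂ (λ₂ ^ k₂) D ⟩
  λ₂ ^ k₂ * (y ^ c₀ * y ^ (k ℕ.* (p ∸ 1))) * (λ₂ * D)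
    ≡⟨ cong₂ (λ e d → λ₂ ^ k₂ * e * d)
             (trans (sym (ℤₚ.^-distribˡ-+-* y c₀ _)) (cong (y ^_) (sym (unit-multiplicity p≤h (suc k₂)))))
             (trans (cong (λ₂ *_) (final-det (suc k₂))) (characteristic-cubic p≤h (suc k₂))) ⟩
  λ₂ ^ k₂ * y ^ (N ∸ k) * sPoly h p k x
    ∎
  where
  open ≡-Reasoning
  open UnionOfCliques h p
  open Merging x
  k = suc (suc k₂)
  N = nV h p k
  D = det 2 (quotient 2 (blocksJoined (suc k₂)))
  regroup : ∀ a b l L d → a * (b * (l * L * d)) ≡ L * (a * b) * (l * d)
  regroup = solve-∀
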